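{- Every $[2]$-trade $T$ of volume $5$ or $6$ is equivalent to a $[2]$-trade of volume $6$ of one of the following four forms (in the group ring $\mathbb Z[2^V]$): (1) $(1-XY_1)(1-XY_2)(1-XY_3)-(1-XZ_1)(1-XZ_2)(1-XZ_3)$, where $X,Y_1,Y_2,Y_3$ are mutually disjoint, $X,Z_1,Z_2,Z_3$ are mutually disjoint, $Y_1,\dots,Z_3$ are mutually different nonempty sets, and $Y_1Y_2Y_3=Z_1Z_2Z_3$; (2) $(1-Y_1)(1-Y_2)(1-Y_3)-(1-Z_1)(1-Z_2)(1-Z_3)$, where $Y_1,Y_2,Y_3$ are mutually disjoint nonempty, $Z_1,Z_2,Z_3$ are mutually disjoint nonempty, all six sets are mutually different, and $Y_1Y_2=Z_1Z_2$; (3) $(1-Y_1)(1-Y_2)(1-Y_3)-(1-Z_1)(1-Z_2)(1-Y_1Y_2Y_3)$, where $Y_1,Y_2,Y_3,Z_1,Z_2$ are mutually disjoint nonempty sets; (4) $(\{Y_1,Y_2,Y_3,XZ_1,XZ_2,XZ_3\},\{Z_1,Z_2,Z_3,XY_1,XY_2,XY_3\})$, where $X,Y_1,Y_2,Y_3$ are mutually disjoint, $X,Z_1,Z_2,Z_3$ are mutually disjoint, $Y_1Y_2Y_3=Z_1Z_2Z_3$, $Y_i\ne Z_j$ for all $i,j$, and $X\ne\emptyset$.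
   Context: Let $V$ be a finite set. Subsets of $V$ form a group under symmetric difference $\oplus$, and we work in the group ring $\mathbb Z[(2^V,\oplus)]$: juxtaposition $XY$ of sets denotes $X\oplus Y$ and $1$ denotes the empty set. A pair $T=(T_+,T_-)$ of disjoint finite multisets of subsets (blocks) is identified with $\sum_X\tau_X X$, where $\tau_X$ is the multiplicity of $X$ in $T_+$, or minus its multiplicity in $T_-$. $T$ is a $[t]$-trade if for each $i\le t$ every $i$-subset of $V$ lies in equally many blocks of $T_+$ as of $T_-$; its volume is $|T_+|=|T_-|$. For $Y\subseteq V$ the $Y$-shift of $T$ is $YT$ (every block $B$ replaced by $Y\oplus B$). Two trades are equivalent if one is obtained from the other by a permutation of the elements of $V$, shifts, and optionally swapping the two legs $T_+$ and $T_-$. -}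

module Defs where

open import Data.Bool using (Bool; true; false; _xor_; if_then_else_)
open import Data.Nat as ℕ using (ℕ; zero; suc)
open import Data.Integer as ℤ using (ℤ; +_; -_; _+_; _-_; _*_; _⊔_)
open import Data.Fin using (Fin)
open import Data.Fin.Subset as S using (Subset; _⊆_; _∩_; ∣_∣; Nonempty)
open import Data.Fin.Subset.Properties using (_⊆?_)
open import Data.Fin.Permutation using (Permutation′; _⟨$⟩ˡ_)
open import Data.Vec as Vec using (Vec; []; _∷_; zipWith; tabulate; lookup)
open import Data.Vec.Properties using (≡-dec)
open import Data.Bool.Properties using () renaming (_≟_ to _≟ᵇ_)
open import Data.List as List using (List; []; _∷_; _++_; map; filter; foldr)
open import Data.Product using (∃; Σ; _×_; _,_)
open import Data.Sum using (_⊎_)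
open import Relation.Nullary using (¬_; yes; no)
open import Relation.Binary.PropositionalEquality using (_≡_; _≢_)
open import Relation.Binary.Construct.Closure.Equivalence using (EqClosure)

-- symmetric difference (the group operation on 2^V, written as juxtaposition in the paper)
_⊕_ : ∀ {n} → Subset n → Subset n → Subset n
_⊕_ = zipWith _xor_
infixl 7 _⊕_

∅ : ∀ {n} → Subset n
∅ = S.⊥

_≟ˢ_ : ∀ {n} (X Y : Subset n) → Relation.Nullary.Dec (X ≡ Y)
_≟ˢ_ = ≡-dec _≟ᵇ_

sumℤ : List ℤ → ℤ
sumℤ = foldr _+_ (+ 0)

allSubsets : ∀ n → List (Subset n)
allSubsets zero = [] ∷ []
allSubsets (suc n) = map (false ∷_) (allSubsets n) ++ map (true ∷_) (allSubsets n)

-- elements of the group ring Z[(2^V, ⊕)] : finitely supported (V finite) functions 2^V → Z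
GR : ℕ → Set
GR n = Subset n → ℤ

_≐_ : ∀ {n} → GR n → GR n → Set
f ≐ g = ∀ X → f X ≡ g X
infix 4 _≐_

⟦_⟧ : ∀ {n} → Subset n → GR n
⟦ X ⟧ W with X ≟ˢ W
... | yes _ = + 1
... | no  _ = + 0

one : ∀ {n} → GR n
one = ⟦ ∅ ⟧

_+ᵍ_ : ∀ {n} → GR n → GR n → GR n
(f +ᵍ g) X = f X + g X

_-ᵍ_ : ∀ {n} → GR n → GR n → GR n
(f -ᵍ g) X = f X - g X

_*ᵍ_ : ∀ {n} → GR n → GR n → GR n
_*ᵍ_ {n} f g X = sumℤ (map (λ Y → f Y * g (Y ⊕ X)) (allSubsets n))

infixl 6 _+ᵍ_ _-ᵍ_
infixl 7 _*ᵍ_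

-- the group-ring element  Σ_{B ∈ T₊} B − Σ_{B ∈ T₋} B  of a pair of (lists representing) multisets
fromPair : ∀ {n} → List (Subset n) → List (Subset n) → GR n
fromPair {n} P M X = + List.length (filter (_≟ˢ X) P) - + List.length (filter (_≟ˢ X) M)

-- A trade (T₊,T₋) of disjoint multisets is identified with Σ τ_X X, i.e. with τ : GR n;
-- T₊ = positive part (multiplicity τ_X), T₋ = negative part (multiplicity −τ_X).

-- sum of τ over blocks containing S:  (#blocks of T₊ ⊇ S) − (#blocks of T₋ ⊇ S)
blocksContaining : ∀ {n} → GR n → Subset n → ℤ
blocksContaining {n} τ S = sumℤ (map τ (filter (S ⊆?_) (allSubsets n)))

IsTrade : ∀ {n} → ℕ → GR n → Set
IsTrade {n} t τ = ∀ (i : ℕ) → i ℕ.≤ t → ∀ (S : Subset n) → ∣ S ∣ ≡ i → blocksContaining τ S ≡ + 0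

volume : ∀ {n} → GR n → ℤ
volume {n} τ = sumℤ (map (λ X → τ X ⊔ + 0) (allSubsets n))

permSet : ∀ {n} → Permutation′ n → Subset n → Subset n
permSet σ X = tabulate (λ i → lookup X (σ ⟨$⟩ˡ i))

data Step {n} (τ τ′ : GR n) : Set where
  perm  : (σ : Permutation′ n) → τ′ ≐ (λ X → τ (permSet σ X)) → Step τ τ′
  shift : (Y : Subset n) → τ′ ≐ (λ X → τ (Y ⊕ X)) → Step τ τ′
  swap  : τ′ ≐ (λ X → - τ X) → Step τ τ′

Equivalent : ∀ {n} → GR n → GR n → Set
Equivalent {n} = EqClosure (Step {n})

Disjoint : ∀ {n} → Subset n → Subset n → Set
Disjoint A B = A ∩ B ≡ ∅

1-_ : ∀ {n} → Subset n → GR n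
1- A = one -ᵍ ⟦ A ⟧

Form1 : ∀ {n} → GR n → Set
Form1 {n} τ = Σ (Subset n) λ X → Σ (Subset n) λ Y₁ → Σ (Subset n) λ Y₂ → Σ (Subset n) λ Y₃ →
  Σ (Subset n) λ Z₁ → Σ (Subset n) λ Z₂ → Σ (Subset n) λ Z₃ →
  Disjoint X Y₁ × Disjoint X Y₂ × Disjoint X Y₃ × Disjoint Y₁ Y₂ × Disjoint Y₁ Y₃ × Disjoint Y₂ Y₃ ×
  Disjoint X Z₁ × Disjoint X Z₂ × Disjoint X Z₃ × Disjoint Z₁ Z₂ × Disjoint Z₁ Z₃ × Disjoint Z₂ Z₃ ×
  Y₁ ≢ Y₂ × Y₁ ≢ Y₃ × Y₁ ≢ Z₁ × Y₁ ≢ Z₂ × Y₁ ≢ Z₃ ×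
  Y₂ ≢ Y₃ × Y₂ ≢ Z₁ × Y₂ ≢ Z₂ × Y₂ ≢ Z₃ ×
  Y₃ ≢ Z₁ × Y₃ ≢ Z₂ × Y₃ ≢ Z₃ ×
  Z₁ ≢ Z₂ × Z₁ ≢ Z₃ × Z₂ ≢ Z₃ ×
  Nonempty Y₁ × Nonempty Y₂ × Nonempty Y₃ × Nonempty Z₁ × Nonempty Z₂ × Nonempty Z₃ ×
  Y₁ ⊕ Y₂ ⊕ Y₃ ≡ Z₁ ⊕ Z₂ ⊕ Z₃ ×
  τ ≐ (1- (X ⊕ Y₁)) *ᵍ (1- (X ⊕ Y₂)) *ᵍ (1- (X ⊕ Y₃)) -ᵍ (1- (X ⊕ Z₁)) *ᵍ (1- (X ⊕ Z₂)) *ᵍ (1- (X ⊕ Z₃))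

Form2 : ∀ {n} → GR n → Set
Form2 {n} τ = Σ (Subset n) λ Y₁ → Σ (Subset n) λ Y₂ → Σ (Subset n) λ Y₃ →
  Σ (Subset n) λ Z₁ → Σ (Subset n) λ Z₂ → Σ (Subset n) λ Z₃ →
  Disjoint Y₁ Y₂ × Disjoint Y₁ Y₃ × Disjoint Y₂ Y₃ ×
  Disjoint Z₁ Z₂ × Disjoint Z₁ Z₃ × Disjoint Z₂ Z₃ ×
  Nonempty Y₁ × Nonempty Y₂ × Nonempty Y₃ × Nonempty Z₁ × Nonempty Z₂ × Nonempty Z₃ ×
  Y₁ ≢ Y₂ × Y₁ ≢ Y₃ × Y₁ ≢ Z₁ × Y₁ ≢ Z₂ × Y₁ ≢ Z₃ ×
  Y₂ ≢ Y₃ × Y₂ ≢ Z₁ × Y₂ ≢ Z₂ × Y₂ ≢ Z₃ ×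
  Y₃ ≢ Z₁ × Y₃ ≢ Z₂ × Y₃ ≢ Z₃ ×
  Z₁ ≢ Z₂ × Z₁ ≢ Z₃ × Z₂ ≢ Z₃ ×
  Y₁ ⊕ Y₂ ≡ Z₁ ⊕ Z₂ ×
  τ ≐ (1- Y₁) *ᵍ (1- Y₂) *ᵍ (1- Y₃) -ᵍ (1- Z₁) *ᵍ (1- Z₂) *ᵍ (1- Z₃)

Form3 : ∀ {n} → GR n → Set
Form3 {n} τ = Σ (Subset n) λ Y₁ → Σ (Subset n) λ Y₂ → Σ (Subset n) λ Y₃ →
  Σ (Subset n) λ Z₁ → Σ (Subset n) λ Z₂ →
  Disjoint Y₁ Y₂ × Disjoint Y₁ Y₃ × Disjoint Y₁ Z₁ × Disjoint Y₁ Z₂ ×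
  Disjoint Y₂ Y₃ × Disjoint Y₂ Z₁ × Disjoint Y₂ Z₂ ×
  Disjoint Y₃ Z₁ × Disjoint Y₃ Z₂ × Disjoint Z₁ Z₂ ×
  Nonempty Y₁ × Nonempty Y₂ × Nonempty Y₃ × Nonempty Z₁ × Nonempty Z₂ ×
  τ ≐ (1- Y₁) *ᵍ (1- Y₂) *ᵍ (1- Y₃) -ᵍ (1- Z₁) *ᵍ (1- Z₂) *ᵍ (1- (Y₁ ⊕ Y₂ ⊕ Y₃))

Form4 : ∀ {n} → GR n → Set
Form4 {n} τ = Σ (Subset n) λ X → Σ (Subset n) λ Y₁ → Σ (Subset n) λ Y₂ → Σ (Subset n) λ Y₃ →
  Σ (Subset n) λ Z₁ → Σ (Subset n) λ Z₂ → Σ (Subset n) λ Z₃ →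
  Disjoint X Y₁ × Disjoint X Y₂ × Disjoint X Y₃ × Disjoint Y₁ Y₂ × Disjoint Y₁ Y₃ × Disjoint Y₂ Y₃ ×
  Disjoint X Z₁ × Disjoint X Z₂ × Disjoint X Z₃ × Disjoint Z₁ Z₂ × Disjoint Z₁ Z₃ × Disjoint Z₂ Z₃ ×
  Y₁ ⊕ Y₂ ⊕ Y₃ ≡ Z₁ ⊕ Z₂ ⊕ Z₃ ×
  Y₁ ≢ Z₁ × Y₁ ≢ Z₂ × Y₁ ≢ Z₃ × Y₂ ≢ Z₁ × Y₂ ≢ Z₂ × Y₂ ≢ Z₃ × Y₃ ≢ Z₁ × Y₃ ≢ Z₂ × Y₃ ≢ Z₃ ×
  Nonempty X ×
  τ ≐ fromPair (Y₁ ∷ Y₂ ∷ Y₃ ∷ X ⊕ Z₁ ∷ X ⊕ Z₂ ∷ X ⊕ Z₃ ∷ [])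
               (Z₁ ∷ Z₂ ∷ Z₃ ∷ X ⊕ Y₁ ∷ X ⊕ Y₂ ∷ X ⊕ Y₃ ∷ [])

{-# OPTIONS --safe #-}
module Submission where

-- Write the blocks of T₊ and T₋ as the rows of a 0/1 matrix with a column for every element of V.  T is a [2]-trade iff
-- any two columns c, d (possibly equal) have as many common ones in T₊ as in T₋.  Shifts complement columns, and
-- whether T has one of the four forms only depends on the set of columns that occur.  So the theorem is a statement
-- about sets of pairwise balanced vectors of length 5+5 or 6+6.  Choose columns one after the other: as no block of T₊
-- equals a block of T₋, some column separates two rows that agree so far; once all rows of T₊ are separated from those
-- of T₋, either all columns have the shape prescribed by one of the forms, or some other column can be chosen.  Up to
-- permutations of the rows, this search meets 345 configurations for volume 6, and for volume 5 it never ends in a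
-- separated configuration.  The search is evaluated by a checker that is proved sound.

open import Defs
open import Data.Nat using (ℕ)
open import Data.Integer using (+_)
open import Data.Product using (Σ; _×_)
open import Data.Sum using (_⊎_)
open import Relation.Binary.PropositionalEquality using (_≡_)

open import Data.Bool using (Bool; true; false; T; not; if_then_else_; _∧_; _∨_; _xor_)
open import Data.Bool.ListAction using (all; any)
open import Data.Bool.Properties using (T-∧; T-∨; T-≡; xor-assoc; xor-comm; xor-same; not-distribˡ-xor) renaming
  (_≟_ to _≟ᵇ_)
open import Data.Empty using (⊥; ⊥-elim)
open import Data.Fin using (Fin; zero; suc; #_)
open import Data.Fin.Subset as S using (Subset; Nonempty; ⁅_⁆; _∪_; ∣_∣)
open import Data.Fin.Subset.Properties using (_⊆?_; ⊥⊆; ∣⊥∣≡0; ∣⁅x⁆∣≡1; x∈⁅x⁆; x∈⁅y⁆⇒x≡y; p⊆p∪q; q⊆p∪q; x∈p∪q⁻;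
  ∪-idem; ∪-identityˡ)
open import Data.List using (List; []; _∷_; _++_; concatMap; filter; filterᵇ; foldl; length; map; replicate; upTo;
  zip; zipWith)
open import Data.List.Membership.Propositional using (_∈_; find)
open import Data.List.Membership.Propositional.Properties
open import Data.List.Properties using (∷-injective; length-map; map-++; map-∘; map-cong; ++-assoc; ++-identityʳ)
open import Data.List.Relation.Binary.Permutation.Propositional using
  (_↭_; ↭-refl; ↭-prep; ↭-swap; ↭-trans; ↭-reflexive)
open import Data.List.Relation.Binary.Permutation.Propositional.Properties using
  (map⁺; ++⁺; filter-↭; ↭-length; ∈-resp-↭) renaming (shift to ↭-shift)
open import Data.List.Relation.Unary.All as All using (All; []; _∷_)
open import Data.List.Relation.Unary.All.Properties using (all⁺)
open import Data.List.Relation.Unary.Any using (here; there)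
open import Data.List.Relation.Unary.Any.Properties using (any⁻)
open import Data.Product using (∃; ∃₂; _,_; proj₁; proj₂)
open import Data.Sum using (inj₁; inj₂; [_,_]′)
open import Data.Unit using (tt)
open import Data.Vec as Vec using (Vec; []; _∷_; lookup; tabulate)
open import Data.Vec.Properties using (lookup-map; lookup-replicate; lookup-zipWith; lookup∘tabulate;
  tabulate∘lookup; tabulate-cong; lookup⇒[]=; []=⇒lookup; zipWith-assoc; zipWith-comm; ∷-injectiveʳ)
open import Function using (_∘_; Equivalence)
open import Relation.Binary.Construct.Closure.Equivalence using (return)
open import Relation.Binary.PropositionalEquality using (_≢_; refl; sym; trans; cong; cong₂; subst; subst₂)
open import Relation.Nullary using (Dec; yes; no; does; contradiction)
open import Relation.Nullary.Decidable using (T?; dec-true; dec-false)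

-- The search has to be small enough to run inside the type checker, and it must not depend on the
-- order of the blocks. A configuration therefore records only how many blocks of each leg show each
-- pattern. The block orders that exhibit a form are never searched for; the certificate supplies
-- them, together with the class to be split at each branching. A column fits a form only up to
-- complementation. The elements of V whose columns are complemented form the set by which T is
-- finally shifted, and this single shift is the whole equivalence. The forms enter after the common
-- terms of their two products have been cancelled; each then has exactly six monomials in each leg.
-- Hence a fit is absurd in volume 5, and the same checker and the same soundness theorem serve both
-- volumes.

module Classification where

  open import Data.Nat
  open import Data.Nat.Divisibility using (n∣m*n)
  open import Data.Nat.DivMod using ([m+kn]%n≡m%n; +-distrib-/-∣ʳ; m*n/n≡m)
  open import Data.Nat.ListAction using (sum)
  open import Data.Nat.ListAction.Properties using (sum-++; sum-↭)
  open import Data.Nat.Properties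

  -- The four forms as lists of admissible columns

  -- A nonempty ⊕-product of the parameters X, Y₁, …, Z₃ of the four forms, given by its indices 𝕩, 𝕪₁, …, 𝕫₃.
  Monomial : Set
  Monomial = Fin 7 × List (Fin 7)

  eval : ∀ {A : Set} → (A → A → A) → (Fin 7 → A) → Monomial → A
  eval _∙_ s (i , is) = foldl (λ a j → a ∙ s j) (s i) is

  record Shape : Set where
    field
      plus minus : List Monomial
      disjoint distinct : List (Fin 7 × Fin 7)
      nonempty unused : List (Fin 7)
      relation : Monomial × Monomial

  open Shape

  pattern 𝕩 = zero
  pattern 𝕪₁ = suc zero
  pattern 𝕪₂ = suc (suc zero)
  pattern 𝕪₃ = suc (suc (suc zero))
  pattern 𝕫₁ = suc (suc (suc (suc zero)))
  pattern 𝕫₂ = suc (suc (suc (suc (suc zero))))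
  pattern 𝕫₃ = suc (suc (suc (suc (suc (suc zero)))))

  -- `plus` and `minus` list the terms left after cancellation. In the first three forms the term 1
  -- cancels together with one further common term: XY₁Y₂Y₃ = XZ₁Z₂Z₃ in the first form, Y₁Y₂ = Z₁Z₂
  -- in the second, Y₁Y₂Y₃ in the third. In the first form X also disappears from the products of
  -- two factors. The fourth form is a pair of legs from the start.
  form₁ form₂ form₃ form₄ : Shape
  form₁ = record
    { plus = (𝕪₁ , 𝕪₂ ∷ []) ∷ (𝕪₁ , 𝕪₃ ∷ []) ∷ (𝕪₂ , 𝕪₃ ∷ []) ∷ (𝕩 , 𝕫₁ ∷ []) ∷ (𝕩 , 𝕫₂ ∷ []) ∷ (𝕩 , 𝕫₃ ∷ []) ∷ []
    ; minus = (𝕫₁ , 𝕫₂ ∷ []) ∷ (𝕫₁ , 𝕫₃ ∷ []) ∷ (𝕫₂ , 𝕫₃ ∷ []) ∷ (𝕩 , 𝕪₁ ∷ []) ∷ (𝕩 , 𝕪₂ ∷ []) ∷ (𝕩 , 𝕪₃ ∷ []) ∷ []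
    ; disjoint = (𝕩 , 𝕪₁) ∷ (𝕩 , 𝕪₂) ∷ (𝕩 , 𝕪₃) ∷ (𝕪₁ , 𝕪₂) ∷ (𝕪₁ , 𝕪₃) ∷ (𝕪₂ , 𝕪₃) ∷
                 (𝕩 , 𝕫₁) ∷ (𝕩 , 𝕫₂) ∷ (𝕩 , 𝕫₃) ∷ (𝕫₁ , 𝕫₂) ∷ (𝕫₁ , 𝕫₃) ∷ (𝕫₂ , 𝕫₃) ∷ []
    ; distinct = (𝕪₁ , 𝕪₂) ∷ (𝕪₁ , 𝕪₃) ∷ (𝕪₁ , 𝕫₁) ∷ (𝕪₁ , 𝕫₂) ∷ (𝕪₁ , 𝕫₃) ∷ (𝕪₂ , 𝕪₃) ∷ (𝕪₂ , 𝕫₁) ∷ (𝕪₂ , 𝕫₂) ∷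
                 (𝕪₂ , 𝕫₃) ∷ (𝕪₃ , 𝕫₁) ∷ (𝕪₃ , 𝕫₂) ∷ (𝕪₃ , 𝕫₃) ∷ (𝕫₁ , 𝕫₂) ∷ (𝕫₁ , 𝕫₃) ∷ (𝕫₂ , 𝕫₃) ∷ []
    ; nonempty = 𝕪₁ ∷ 𝕪₂ ∷ 𝕪₃ ∷ 𝕫₁ ∷ 𝕫₂ ∷ 𝕫₃ ∷ []
    ; unused = []
    ; relation = (𝕪₁ , 𝕪₂ ∷ 𝕪₃ ∷ []) , (𝕫₁ , 𝕫₂ ∷ 𝕫₃ ∷ [])
    }
  form₂ = record
    { plus = (𝕪₁ , 𝕪₃ ∷ []) ∷ (𝕪₂ , 𝕪₃ ∷ []) ∷ (𝕫₁ , []) ∷ (𝕫₂ , []) ∷ (𝕫₃ , []) ∷ (𝕫₁ , 𝕫₂ ∷ 𝕫₃ ∷ []) ∷ []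
    ; minus = (𝕫₁ , 𝕫₃ ∷ []) ∷ (𝕫₂ , 𝕫₃ ∷ []) ∷ (𝕪₁ , []) ∷ (𝕪₂ , []) ∷ (𝕪₃ , []) ∷ (𝕪₁ , 𝕪₂ ∷ 𝕪₃ ∷ []) ∷ []
    ; disjoint = (𝕪₁ , 𝕪₂) ∷ (𝕪₁ , 𝕪₃) ∷ (𝕪₂ , 𝕪₃) ∷ (𝕫₁ , 𝕫₂) ∷ (𝕫₁ , 𝕫₃) ∷ (𝕫₂ , 𝕫₃) ∷ []
    ; distinct = distinct form₁
    ; nonempty = nonempty form₁
    ; unused = 𝕩 ∷ []
    ; relation = (𝕪₁ , 𝕪₂ ∷ []) , (𝕫₁ , 𝕫₂ ∷ [])
    }
  form₃ = record
    { plus = (𝕪₁ , 𝕪₂ ∷ []) ∷ (𝕪₁ , 𝕪₃ ∷ []) ∷ (𝕪₂ , 𝕪₃ ∷ []) ∷ (𝕫₁ , []) ∷ (𝕫₂ , []) ∷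
      (𝕫₁ , 𝕫₂ ∷ 𝕪₁ ∷ 𝕪₂ ∷ 𝕪₃ ∷ []) ∷ []
    ; minus = (𝕫₁ , 𝕫₂ ∷ []) ∷ (𝕫₁ , 𝕪₁ ∷ 𝕪₂ ∷ 𝕪₃ ∷ []) ∷ (𝕫₂ , 𝕪₁ ∷ 𝕪₂ ∷ 𝕪₃ ∷ []) ∷ (𝕪₁ , []) ∷ (𝕪₂ , []) ∷
      (𝕪₃ , []) ∷ []
    ; disjoint = (𝕪₁ , 𝕪₂) ∷ (𝕪₁ , 𝕪₃) ∷ (𝕪₁ , 𝕫₁) ∷ (𝕪₁ , 𝕫₂) ∷ (𝕪₂ , 𝕪₃) ∷ (𝕪₂ , 𝕫₁) ∷ (𝕪₂ , 𝕫₂) ∷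
                 (𝕪₃ , 𝕫₁) ∷ (𝕪₃ , 𝕫₂) ∷ (𝕫₁ , 𝕫₂) ∷ []
    ; distinct = []
    ; nonempty = 𝕪₁ ∷ 𝕪₂ ∷ 𝕪₃ ∷ 𝕫₁ ∷ 𝕫₂ ∷ []
    ; unused = 𝕩 ∷ 𝕫₃ ∷ []
    ; relation = (𝕩 , []) , (𝕩 , [])  -- no relation
    }
  form₄ = record
    { plus = (𝕪₁ , []) ∷ (𝕪₂ , []) ∷ (𝕪₃ , []) ∷ (𝕩 , 𝕫₁ ∷ []) ∷ (𝕩 , 𝕫₂ ∷ []) ∷ (𝕩 , 𝕫₃ ∷ []) ∷ []
    ; minus = (𝕫₁ , []) ∷ (𝕫₂ , []) ∷ (𝕫₃ , []) ∷ (𝕩 , 𝕪₁ ∷ []) ∷ (𝕩 , 𝕪₂ ∷ []) ∷ (𝕩 , 𝕪₃ ∷ []) ∷ []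
    ; disjoint = disjoint form₁
    ; distinct = (𝕪₁ , 𝕫₁) ∷ (𝕪₁ , 𝕫₂) ∷ (𝕪₁ , 𝕫₃) ∷ (𝕪₂ , 𝕫₁) ∷ (𝕪₂ , 𝕫₂) ∷ (𝕪₂ , 𝕫₃) ∷
                 (𝕪₃ , 𝕫₁) ∷ (𝕪₃ , 𝕫₂) ∷ (𝕪₃ , 𝕫₃) ∷ []
    ; nonempty = 𝕩 ∷ []
    ; unused = []
    ; relation = relation form₁
    }

  -- These are the conditions that hold for the parameter sets as soon as they hold at every element
  -- of V. Nonemptiness and distinctness, which require one suitable element, are left to `tests`.
  admissible : Shape → Subset 7 → Bool
  admissible F e =
    all (λ i → not (lookup e i)) (unused F) ∧
    all (λ (i , j) → not (lookup e i ∧ lookup e j)) (disjoint F) ∧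
    does (eval _xor_ (lookup e) (proj₁ (relation F)) ≟ᵇ eval _xor_ (lookup e) (proj₂ (relation F)))

  -- The possible membership vectors of one element of V in the seven parameter sets.
  table : Shape → List (Subset 7)
  table F = filterᵇ (admissible F) (allSubsets 7)

  Entry : Set
  Entry = Subset 7 × List Bool × List Bool

  values : Bool → List Monomial → Subset 7 → List Bool
  values b ms e = map (λ m → b xor eval _xor_ (lookup e) m) ms

  -- The column of the block matrix at an element of V with membership vector e (b: the element lies in the shift).
  entry : Shape → Bool → Subset 7 → Entry
  entry F b e = e , values b (plus F) e , values b (minus F) e

  entriesOn : Shape → List (Subset 7) → List Entry
  entriesOn F es = map (entry F false) es ++ map (entry F true) es

  entries : Shape → List Entry
  entries F = entriesOn F (table F)

  tests : Shape → List (Subset 7 → Bool)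
  tests F = map (λ i e → lookup e i) (nonempty F) ++ map (λ (i , j) e → lookup e i xor lookup e j) (distinct F)

  -- Configurations and the checker

  -- (w , a , b): a blocks of T₊ and b blocks of T₋ have the pattern w on the columns chosen so far.  The pattern is
  -- the decimal number with leading digit 1 followed by the bits; the last digit belongs to the newest column.
  Class : Set
  Class = ℕ × ℕ × ℕ

  State : Set
  State = List Class

  -- The number of chosen columns and the resulting state.
  Node : Set
  Node = ℕ × State

  sameState : State → State → Bool
  sameState [] [] = true
  sameState ((w , a , b) ∷ s) ((w′ , a′ , b′) ∷ s′) =
    (w ≡ᵇ w′) ∧ (a ≡ᵇ a′) ∧ (b ≡ᵇ b′) ∧ sameState s s′
  sameState _ _ = false

  sameNode : Node → Node → Bool
  sameNode (d , s) (d′ , s′) = (d ≡ᵇ d′) ∧ sameState s s′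

  plusCounts minusCounts codes : State → List ℕ
  plusCounts = map (λ c → proj₁ (proj₂ c))
  minusCounts = map (λ c → proj₂ (proj₂ c))
  codes = map proj₁

  increment : List ℕ → List ℕ
  increment [] = []
  increment (k ∷ ks) = suc k ∷ ks

  choices : List ℕ → ℕ → List (List ℕ)
  choices [] zero = [] ∷ []
  choices [] (suc _) = []
  choices (zero ∷ as) c = map (0 ∷_) (choices as c)
  choices (suc a ∷ as) zero = map (0 ∷_) (choices as zero)
  choices (suc a ∷ as) (suc c) = map (0 ∷_) (choices as (suc c)) ++ map increment (choices (a ∷ as) c)

  data Weighted : Set where
    _⟪_ : ℕ → List ℕ → Weighted

  weight : List ℕ → List ℕ → ℕ
  weight (w ∷ ws) (k ∷ ks) = w * k + weight ws ks
  weight _ _ = 0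

  weighted : List ℕ → List ℕ → ℕ → List Weighted
  weighted ws as c = map (λ ks → weight ws ks ⟪ ks) (choices as c)

  scan : (List ℕ → Bool) → ℕ → List Weighted → Bool
  scan ok u [] = true
  scan ok u ((v ⟪ ls) ∷ ms) = if u ≡ᵇ v then ok ls ∧ scan ok u ms else scan ok u ms

  meet : (List ℕ → List ℕ → Bool) → List Weighted → List Weighted → Bool
  meet ok [] ms = true
  meet ok ((u ⟪ ks) ∷ us) ms = scan (ok ks) u ms ∧ meet ok us ms

  -- A new column that contains k_i, l_i blocks of the i-th class is balanced against every chosen column.  All these
  -- equations are digits of the single equation Σ w_i k_i = Σ w_i l_i.  Up to complementation, a column contains at
  -- most 3 of at most 7 blocks of T₊.
  allBalanced : (List ℕ → List ℕ → Bool) → State → Bool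
  allBalanced ok st =
    all (λ c → meet ok (weighted (codes st) (plusCounts st) c) (weighted (codes st) (minusCounts st) c)) (upTo 4)

  class : ℕ → ℕ → ℕ → State → State
  class w zero zero st = st
  class w a b st = (w , a , b) ∷ st

  -- The two parts of a class take its place, bit 0 before bit 1, and empty parts are dropped. So
  -- the codes of a state stay increasing, and a sequence of columns has only one state; `sameState`
  -- may compare literally.
  split : State → List ℕ → List ℕ → State
  split ((w , a , b) ∷ st) (k ∷ ks) (l ∷ ls) =
    class (w * 10) (a ∸ k) (b ∸ l) (class (1 + w * 10) k l (split st ks ls))
  split _ _ _ = []

  -- Only speeds up the search in Γ: nodes with the same fingerprint are still compared.
  fingerprint : State → ℕ
  fingerprint [] = 0
  fingerprint ((w , a , b) ∷ st) = b + 10 * (a + 10 * (w + 1000000 * fingerprint st))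

  Known : Set
  Known = ℕ × Node

  member : List Known → ℕ → Node → Bool
  member [] h s = false
  member ((h′ , t) ∷ Γ) h s = if h ≡ᵇ h′ then sameNode t s ∨ member Γ h s else member Γ h s

  -- A column and its complement are interchangeable.
  known : List Known → Node → List ℕ → List ℕ → Bool
  known Γ (d , st) ks ls = mem (split st ks ls) ∨ mem (split st (co plusCounts ks) (co minusCounts ls))
    where
    co : (State → List ℕ) → List ℕ → List ℕ
    co counts = zipWith _∸_ (counts st)
    mem : State → Bool
    mem s = member Γ (fingerprint s) (suc d , s)

  isMixed : ℕ → State → Bool
  isMixed zero ((_ , a , b) ∷ _) = not (a ≡ᵇ 0) ∧ not (b ≡ᵇ 0)
  isMixed (suc i) (_ ∷ st) = isMixed i st
  isMixed _ [] = false

  unsplit : ℕ → State → List ℕ → List ℕ → Bool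
  unsplit zero ((_ , a , b) ∷ _) (k ∷ _) (l ∷ _) = ((k ≡ᵇ 0) ∧ (l ≡ᵇ 0)) ∨ ((k ≡ᵇ a) ∧ (l ≡ᵇ b))
  unsplit (suc i) (_ ∷ st) (_ ∷ ks) (_ ∷ ls) = unsplit i st ks ls
  -- This permissive default is safe because `follows` also demands `isMixed i st`, so that the
  -- `i`-th class exists.
  unsplit _ _ _ _ = true

  steady : List ℕ → List ℕ → Bool
  steady as ks = all (λ (a , k) → (k ≡ᵇ 0) ∨ (k ≡ᵇ a)) (zip as ks)

  flat : List ℕ → List ℕ → List Bool
  flat (a ∷ as) (k ∷ ks) = replicate a (not (k ≡ᵇ 0)) ++ flat as ks
  flat _ _ = []

  insert : ∀ {A : Set} → ℕ → A → List A → List A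
  insert (suc k) a (b ∷ bs) = b ∷ insert k a bs
  insert _ a bs = a ∷ bs

  -- Every list of naturals is a valid insertion code, so the result is a permutation without further conditions.
  arrange : ∀ {A : Set} → List ℕ → List A → List A
  arrange (k ∷ ks) (a ∷ as) = insert k a (arrange ks as)
  arrange _ as = as

  same : List Bool → List Bool → Bool
  same [] [] = true
  same (b ∷ bs) (c ∷ cs) = not (b xor c) ∧ same bs cs
  same _ _ = false

  matches : List Bool → List Bool → Entry → Bool
  matches p m (_ , p′ , m′) = same p p′ ∧ same m m′

  column : (State → List ℕ) → State → List Bool
  column counts st = concatMap (λ (w , a) → replicate a (w % 10 ≡ᵇ 1)) (zip (codes st) (counts st))

  older : State → State
  older = map (λ (w , a , b) → (w / 10 , a , b))

  -- A node does not store its columns; they are read back from the digits of the codes, newest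
  -- first.
  columnsOf : ℕ → State → List (List Bool × List Bool)
  columnsOf zero st = []
  columnsOf (suc d) st = (column plusCounts st , column minusCounts st) ∷ columnsOf d (older st)

  shapes : Vec Shape 4
  shapes = form₁ ∷ form₂ ∷ form₃ ∷ form₄ ∷ []

  -- The checker takes the tables as an argument, so that they are evaluated only once.
  Catalogue : Set
  Catalogue = Vec (List (Subset 7 → Bool) × List Entry) 4

  catalogue : Catalogue
  catalogue = Vec.map (λ F → tests F , entries F) shapes

  -- mixed i: the i-th class has blocks of both legs, so some column splits it.  fits F π ρ: with the blocks permuted by
  -- π and ρ, every column is a column of form F or leads to a node treated before, and the columns already chosen
  -- witness that the parameters are nonempty and distinct.
  data Rule : Set where
    mixed : ℕ → Rule
    fits : Fin 4 → List ℕ → List ℕ → Rule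

  candidates : List ℕ → List ℕ → List Entry → List Bool × List Bool → List (Subset 7)
  candidates π ρ E (p , m) = map proj₁ (filterᵇ (matches (arrange π p) (arrange ρ m)) E)

  -- Several membership vectors may produce the same column, and soundness does not control which of
  -- them is picked. A chosen column therefore passes a test only if all its candidates do. An empty
  -- list of candidates does no harm: `witness` shows that the picked vector is a candidate.
  allRealized : List (List (Subset 7)) → List (Subset 7 → Bool) → Bool
  allRealized css = all (λ t → any (all t) css)

  -- A steady column separates no two blocks of one leg that agree so far, so the state determines
  -- it completely and it can be looked up in the table. Every other column, and every steady one
  -- outside the table, has to lead to a known node.
  fitsWith : List Known → Node → List ℕ → List ℕ → List (Subset 7 → Bool) × List Entry → Bool
  fitsWith Γ (d , st) π ρ (ts , E) =
    allRealized (map (candidates π ρ E) (columnsOf d st)) ts ∧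
    allBalanced (λ ks ls →
      (steady (plusCounts st) ks ∧ steady (minusCounts st) ls ∧
        any (matches (arrange π (flat (plusCounts st) ks)) (arrange ρ (flat (minusCounts st) ls))) E)
      ∨ known Γ (d , st) ks ls) st

  -- A `mixed` node without known successors is a dead end: some column must split the class, but no
  -- balanced column does.
  follows : Catalogue → List Known → Node → Rule → Bool
  follows C Γ (d , st) (mixed i) =
    isMixed i st ∧ allBalanced (λ ks ls → unsplit i st ks ls ∨ known Γ (d , st) ks ls) st
  follows C Γ s (fits i π ρ) = fitsWith Γ s π ρ (lookup C i)

  valid : Catalogue → Node → List Known → List (Node × Rule) → Bool
  valid C root Γ [] = any (λ (_ , t) → sameNode t root) Γ
  valid C root Γ ((s , r) ∷ cs) = follows C Γ s r ∧ valid C root ((fingerprint (proj₂ s) , s) ∷ Γ) cs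

  -- Least significant digit first.
  digits : (base : ℕ) .{{_ : NonZero base}} → ℕ → ℕ → List ℕ
  digits base zero c = []
  digits base (suc k) c = c % base ∷ digits base k (c / base)

  fitting : Fin 4 → ℕ → ℕ → Rule
  fitting i π ρ = fits i (digits 10 6 π) (digits 10 6 ρ)

  count : ℕ → List ℕ → ℕ
  count c rs = length (filterᵇ (_≡ᵇ c) rs)

  binary : ℕ → ℕ → ℕ
  binary zero c = 1
  binary (suc d) c = c % 2 + binary d (c / 2) * 10

  -- p and m list the k blocks of each leg by their patterns on d columns, with two decimal digits for each pattern.
  node : ℕ → ℕ → ℕ → ℕ → Node
  node k d p m = d , go (2 ^ d) 0
    where
    ps = digits 100 k p
    ms = digits 100 k m
    go : ℕ → ℕ → State
    go zero c = []
    go (suc f) c = class (binary d c) (count c ps) (count c ms) (go f (suc c))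

  -- Counting, rearranging, and soundness of the enumeration

  private variable
    A B : Set

  T-∧⁻ : ∀ {b c} → T (b ∧ c) → T b × T c
  T-∧⁻ = Equivalence.to T-∧

  T-∨⁻ : ∀ {b c} → T (b ∨ c) → T b ⊎ T c
  T-∨⁻ = Equivalence.to T-∨

  bit : Bool → ℕ
  bit false = 0
  bit true = 1

  total : (A → ℕ) → List A → ℕ
  total f rs = sum (map f rs)

  total-++ : ∀ (f : A → ℕ) xs ys → total f (xs ++ ys) ≡ total f xs + total f ys
  total-++ f xs ys = trans (cong sum (map-++ f xs ys)) (sum-++ (map f xs) _)

  total-↭ : ∀ (f : A → ℕ) {xs ys} → xs ↭ ys → total f xs ≡ total f ys
  total-↭ f p = sum-↭ (map⁺ f p)

  total-cong : ∀ {f g : A → ℕ} → (∀ r → f r ≡ g r) → ∀ xs → total f xs ≡ total g xs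
  total-cong f≗g xs = cong sum (map-cong f≗g xs)

  cnt : (A → Bool) → List A → ℕ
  cnt κ = total (bit ∘ κ)

  cnt≤length : ∀ (κ : A → Bool) rs → cnt κ rs ≤ length rs
  cnt≤length κ [] = z≤n
  cnt≤length κ (r ∷ rs) with κ r
  ... | false = m≤n⇒m≤1+n (cnt≤length κ rs)
  ... | true = s≤s (cnt≤length κ rs)

  cnt-not : ∀ (κ : A → Bool) rs → cnt (not ∘ κ) rs + cnt κ rs ≡ length rs
  cnt-not κ [] = refl
  cnt-not κ (r ∷ rs) with κ r
  ... | false = cong suc (cnt-not κ rs)
  ... | true = trans (+-suc _ _) (cong suc (cnt-not κ rs))

  cnt-not∸ : ∀ (κ : A → Bool) rs → cnt (not ∘ κ) rs ≡ length rs ∸ cnt κ rs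
  cnt-not∸ κ rs = sym (trans (cong (_∸ cnt κ rs) (sym (cnt-not κ rs))) (m+n∸n≡m (cnt (not ∘ κ) rs) (cnt κ rs)))

  length-filterᵇ : ∀ (κ : A → Bool) rs → length (filterᵇ κ rs) ≡ cnt κ rs
  length-filterᵇ κ [] = refl
  length-filterᵇ κ (r ∷ rs) with κ r
  ... | false = length-filterᵇ κ rs
  ... | true = cong suc (length-filterᵇ κ rs)

  filterᵇ-partition : ∀ (κ : A → Bool) rs → filterᵇ (not ∘ κ) rs ++ filterᵇ κ rs ↭ rs
  filterᵇ-partition κ [] = ↭-refl
  filterᵇ-partition κ (r ∷ rs) with κ r
  ... | false = ↭-prep r (filterᵇ-partition κ rs)
  ... | true = ↭-trans (↭-shift r (filterᵇ (not ∘ κ) rs) _) (↭-prep r (filterᵇ-partition κ rs))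

  constant-∈ : ∀ (κ : A → Bool) rs {r} → r ∈ rs → cnt κ rs ≡ 0 → κ r ≡ false
  constant-∈ κ (r ∷ rs) p e with κ r in eq
  constant-∈ κ (r ∷ rs) (here refl) e | false = eq
  constant-∈ κ (r ∷ rs) (there p) e | false = constant-∈ κ rs p e

  not-injective : ∀ {b} → not b ≡ false → b ≡ true
  not-injective {true} _ = refl

  constant-full : ∀ (κ : A → Bool) rs {r} → r ∈ rs → cnt κ rs ≡ length rs → κ r ≡ true
  constant-full κ rs p e = not-injective (constant-∈ (not ∘ κ) rs p
    (trans (cnt-not∸ κ rs) (trans (cong (length rs ∸_) e) (n∸n≡0 (length rs)))))

  map-constant : ∀ (κ : A → Bool) b rs → (∀ {r} → r ∈ rs → κ r ≡ b) → map κ rs ≡ replicate (length rs) b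
  map-constant κ b [] h = refl
  map-constant κ b (r ∷ rs) h = cong₂ _∷_ (h (here refl)) (map-constant κ b rs (h ∘ there))

  insert-↭ : ∀ k (a : A) as → insert k a as ↭ a ∷ as
  insert-↭ zero a [] = ↭-refl
  insert-↭ zero a (b ∷ as) = ↭-refl
  insert-↭ (suc k) a [] = ↭-refl
  insert-↭ (suc k) a (b ∷ as) = ↭-trans (↭-prep b (insert-↭ k a as)) (↭-swap b a ↭-refl)

  arrange-↭ : ∀ ks (as : List A) → arrange ks as ↭ as
  arrange-↭ [] as = ↭-refl
  arrange-↭ (k ∷ ks) [] = ↭-refl
  arrange-↭ (k ∷ ks) (a ∷ as) = ↭-trans (insert-↭ k a (arrange ks as)) (↭-prep a (arrange-↭ ks as))

  insert-map : ∀ (f : A → B) k a as → map f (insert k a as) ≡ insert k (f a) (map f as)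
  insert-map f zero a [] = refl
  insert-map f zero a (b ∷ as) = refl
  insert-map f (suc k) a [] = refl
  insert-map f (suc k) a (b ∷ as) = cong (f b ∷_) (insert-map f k a as)

  arrange-map : ∀ (f : A → B) ks as → map f (arrange ks as) ≡ arrange ks (map f as)
  arrange-map f [] as = refl
  arrange-map f (k ∷ ks) [] = refl
  arrange-map f (k ∷ ks) (a ∷ as) = trans (insert-map f k a (arrange ks as))
      (cong (insert k (f a)) (arrange-map f ks as))

  same-sound : ∀ bs cs → T (same bs cs) → bs ≡ cs
  same-sound [] [] t = refl
  same-sound (false ∷ bs) (false ∷ cs) t = cong (false ∷_) (same-sound bs cs t)
  same-sound (true ∷ bs) (true ∷ cs) t = cong (true ∷_) (same-sound bs cs t)

  same-refl : ∀ bs → T (same bs bs)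
  same-refl [] = _
  same-refl (false ∷ bs) = same-refl bs
  same-refl (true ∷ bs) = same-refl bs

  sameState-sound : ∀ s t → T (sameState s t) → s ≡ t
  sameState-sound [] [] _ = refl
  sameState-sound ((w , a , b) ∷ s) ((w′ , a′ , b′) ∷ t) h with T-∧⁻ {w ≡ᵇ w′} h
  ... | hw , h₁ with T-∧⁻ {a ≡ᵇ a′} h₁
  ... | ha , h₂ with T-∧⁻ {b ≡ᵇ b′} h₂
  ... | hb , h₃ with refl ← ≡ᵇ⇒≡ w w′ hw | refl ← ≡ᵇ⇒≡ a a′ ha | refl ← ≡ᵇ⇒≡ b b′ hb = cong (_ ∷_)
      (sameState-sound s t h₃)

  sameNode-sound : ∀ s t → T (sameNode s t) → s ≡ t
  sameNode-sound (d , s) (d′ , t) h with T-∧⁻ {d ≡ᵇ d′} h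
  ... | hd , hs = cong₂ _,_ (≡ᵇ⇒≡ d d′ hd) (sameState-sound s t hs)

  ∈-choices : ∀ {a k c as ks} → k ≤ a → ks ∈ choices as c → k ∷ ks ∈ choices (a ∷ as) (k + c)
  ∈-choices {zero} z≤n p = ∈-map⁺ (0 ∷_) p
  ∈-choices {suc a} {zero} {zero} z≤n p = ∈-map⁺ (0 ∷_) p
  ∈-choices {suc a} {zero} {suc c} z≤n p = ∈-++⁺ˡ (∈-map⁺ (0 ∷_) p)
  ∈-choices {suc a} {suc k} {c} {as} (s≤s k≤a) p =
    ∈-++⁺ʳ (map (0 ∷_) (choices as (suc k + c))) (∈-map⁺ increment (∈-choices {as = as} k≤a p))

  scan-sound : ∀ ok u ms {ls} → T (scan ok u ms) → (u ⟪ ls) ∈ ms → T (ok ls)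
  scan-sound ok u ((v ⟪ ls) ∷ ms) t p with u ≡ᵇ v in eq
  scan-sound ok u ((v ⟪ ls) ∷ ms) t (here refl) | true = proj₁ (T-∧⁻ t)
  scan-sound ok u ((v ⟪ ls) ∷ ms) t (there p) | true = scan-sound ok u ms (proj₂ (T-∧⁻ {ok ls} t)) p
  scan-sound ok u ((v ⟪ ls) ∷ ms) t (here refl) | false = ⊥-elim (subst T eq (≡⇒≡ᵇ u u refl))
  scan-sound ok u ((v ⟪ ls) ∷ ms) t (there p) | false = scan-sound ok u ms t p

  meet-sound : ∀ ok us ms {u ks ls} → T (meet ok us ms) → (u ⟪ ks) ∈ us → (u ⟪ ls) ∈ ms → T (ok ks ls)
  meet-sound ok ((u ⟪ ks) ∷ us) ms t (here refl) q = scan-sound (ok ks) u ms (proj₁ (T-∧⁻ t)) q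
  meet-sound ok ((u ⟪ ks) ∷ us) ms t (there p) q = meet-sound ok us ms (proj₂ (T-∧⁻ {scan (ok ks) u ms} t)) p q

  allBalanced-sound : ∀ ok st {c ks ls} → T (allBalanced ok st) → c < 4 →
    ks ∈ choices (plusCounts st) c → ls ∈ choices (minusCounts st) c →
    weight (codes st) ks ≡ weight (codes st) ls → T (ok ks ls)
  allBalanced-sound ok st {c} {ks} t c<4 p q e = meet-sound ok _ _
    (All.lookup (all⁺ (λ c → meet ok (weighted (codes st) (plusCounts st) c)
        (weighted (codes st) (minusCounts st) c)) (upTo 4) t) (∈-upTo⁺ c<4))
    (∈-map⁺ (λ ks → weight (codes st) ks ⟪ ks) p)
    (subst (λ u → (u ⟪ _) ∈ weighted (codes st) (minusCounts st) c) (sym e)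
        (∈-map⁺ (λ ks → weight (codes st) ks ⟪ ks) q))

  digit : ∀ b c → (bit b + c * 10) % 10 ≡ bit b
  digit false c = [m+kn]%n≡m%n 0 c 10
  digit true c = [m+kn]%n≡m%n 1 c 10

  shift-digit : ∀ b c → (bit b + c * 10) / 10 ≡ c
  shift-digit b c = trans (+-distrib-/-∣ʳ (bit b) (n∣m*n c {10})) (cong₂ _+_ (small b) (m*n/n≡m c 10))
    where
    small : ∀ b → bit b / 10 ≡ 0
    small false = refl
    small true = refl

  member-sound : ∀ Γ h s → T (member Γ h s) → ∃ λ h′ → (h′ , s) ∈ Γ
  member-sound ((h′ , t) ∷ Γ) h s m with h ≡ᵇ h′
  ... | false with h″ , p ← member-sound Γ h s m = h″ , there p
  ... | true with T-∨⁻ {sameNode t s} m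
  ...   | inj₁ e with refl ← sameNode-sound t s e = h′ , here refl
  ...   | inj₂ m′ with h″ , p ← member-sound Γ h s m′ = h″ , there p

  -- Lists of blocks that realize a configuration

  module _ {A : Set} where

    private variable
      κs : List (A → Bool)
      st : State
      P M : List A

    code : List (A → Bool) → A → ℕ
    code [] r = 1
    code (κ ∷ κs) r = bit (κ r) + code κs r * 10

    -- `P` and `M` list the blocks class by class in the order of the state. This lets a column
    -- `map κ P` be computed from the state alone, as in `flat-plus` and `column-plus`.
    data Realizes (κs : List (A → Bool)) : State → List A → List A → Set where
      [] : Realizes κs [] [] []
      block : ∀ {w st P M} ps ms → All (λ r → code κs r ≡ w) ps → All (λ r → code κs r ≡ w) ms →
        Realizes κs st P M → Realizes κs ((w , length ps , length ms) ∷ st) (ps ++ P) (ms ++ M)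

    plusChoice minusChoice : (A → Bool) → Realizes κs st P M → List ℕ
    plusChoice κ [] = []
    plusChoice κ (block ps ms _ _ R) = cnt κ ps ∷ plusChoice κ R
    minusChoice κ [] = []
    minusChoice κ (block ps ms _ _ R) = cnt κ ms ∷ minusChoice κ R

    weight-block : ∀ (κ : A → Bool) (f : A → ℕ) w ps → All (λ r → f r ≡ w) ps → total (λ r → bit (κ r) * f r) ps
        ≡ w * cnt κ ps
    weight-block κ f w [] [] = sym (*-zeroʳ w)
    weight-block κ f w (r ∷ ps) (refl ∷ h) = trans (cong (_+_ (bit (κ r) * w)) (weight-block κ f w ps h))
      (trans (cong (_+ w * cnt κ ps) (*-comm (bit (κ r)) w)) (sym (*-distribˡ-+ w (bit (κ r)) (cnt κ ps))))

    -- All blocks of a class have its code, so the sum over classes is a sum over blocks. In this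
    -- shape it no longer depends on the order of the blocks.
    weight-plus : ∀ (κ : A → Bool) (R : Realizes κs st P M) →
      weight (codes st) (plusChoice κ R) ≡ total (λ r → bit (κ r) * code κs r) P
    weight-plus κ [] = refl
    weight-plus {κs = κs} κ (block ps ms hp _ R) = trans
      (cong₂ _+_ (sym (weight-block κ (code κs) _ ps hp)) (weight-plus κ R)) (sym (total-++ _ ps _))

    weight-minus : ∀ (κ : A → Bool) (R : Realizes κs st P M) →
      weight (codes st) (minusChoice κ R) ≡ total (λ r → bit (κ r) * code κs r) M
    weight-minus κ [] = refl
    weight-minus {κs = κs} κ (block ps ms _ hm R) = trans
      (cong₂ _+_ (sym (weight-block κ (code κs) _ ms hm)) (weight-minus κ R)) (sym (total-++ _ ms _))

    plus∈choices : ∀ (κ : A → Bool) (R : Realizes κs st P M) → plusChoice κ R ∈ choices (plusCounts st) (cnt κ P)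
    plus∈choices κ [] = here refl
    plus∈choices κ (block {w} {st} {P} ps ms _ _ R) = subst (λ c → cnt κ ps ∷ plusChoice κ R ∈ choices
        (length ps ∷ plusCounts st) c)
      (sym (total-++ (bit ∘ κ) ps P)) (∈-choices {as = plusCounts st} (cnt≤length κ ps) (plus∈choices κ R))

    minus∈choices : ∀ (κ : A → Bool) (R : Realizes κs st P M) → minusChoice κ R ∈ choices (minusCounts st) (cnt κ M)
    minus∈choices κ [] = here refl
    minus∈choices κ (block {w} {st} {P} {M} ps ms _ _ R) = subst
        (λ c → cnt κ ms ∷ minusChoice κ R ∈ choices (length ms ∷ minusCounts st) c)
      (sym (total-++ (bit ∘ κ) ms M)) (∈-choices {as = minusCounts st} (cnt≤length κ ms) (minus∈choices κ R))

    class-realizes : ∀ {κs : List (A → Bool)} w ps ms {st P M} → All (λ r → code κs r ≡ w) ps →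
        All (λ r → code κs r ≡ w) ms →
      Realizes κs st P M → Realizes κs (class w (length ps) (length ms) st) (ps ++ P) (ms ++ M)
    class-realizes w [] [] _ _ R = R
    class-realizes w [] (m ∷ ms) hp hm R = block [] (m ∷ ms) hp hm R
    class-realizes w (p ∷ ps) [] hp hm R = block (p ∷ ps) [] hp hm R
    class-realizes w (p ∷ ps) (m ∷ ms) hp hm R = block (p ∷ ps) (m ∷ ms) hp hm R

    code-false : ∀ (κs : List (A → Bool)) κ {w} rs → All (λ r → code κs r ≡ w) rs →
      All (λ r → code (κ ∷ κs) r ≡ w * 10) (filterᵇ (not ∘ κ) rs)
    code-false κs κ [] [] = []
    code-false κs κ (r ∷ rs) (e ∷ h) with κ r in eq
    ... | true = code-false κs κ rs h
    ... | false = cong₂ (λ b c → bit b + c * 10) eq e ∷ code-false κs κ rs h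

    code-true : ∀ (κs : List (A → Bool)) κ {w} rs → All (λ r → code κs r ≡ w) rs →
      All (λ r → code (κ ∷ κs) r ≡ 1 + w * 10) (filterᵇ κ rs)
    code-true κs κ [] [] = []
    code-true κs κ (r ∷ rs) (e ∷ h) with κ r in eq
    ... | false = code-true κs κ rs h
    ... | true = cong₂ (λ b c → bit b + c * 10) eq e ∷ code-true κs κ rs h

    merge-↭ : ∀ (κ : A → Bool) ps {P P′} → P′ ↭ P → filterᵇ (not ∘ κ) ps ++ filterᵇ κ ps ++ P′ ↭ ps ++ P
    merge-↭ κ ps {P} {P′} σ = ↭-trans (↭-reflexive (sym (++-assoc (filterᵇ (not ∘ κ) ps) (filterᵇ κ ps) P′)))
      (++⁺ (filterᵇ-partition κ ps) σ)

    -- The new lists arise by moving, within every class, the blocks outside `κ` in front of those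
    -- in `κ`.
    split-realizes : ∀ (κ : A → Bool) (R : Realizes κs st P M) → ∃₂ λ P′ M′ → P′ ↭ P × M′ ↭ M ×
      Realizes (κ ∷ κs) (split st (plusChoice κ R) (minusChoice κ R)) P′ M′
    split-realizes κ [] = [] , [] , ↭-refl , ↭-refl , []
    split-realizes {κs = κs} κ (block {w} ps ms hp hm R)
      with P′ , M′ , σ , τ , R′ ← split-realizes κ R
      -- The numbers computed by `split` are turned into lengths of filtered lists, the form in
      -- which `class-realizes` produces them.
      rewrite sym (cnt-not∸ κ ps) | sym (cnt-not∸ κ ms)
            | sym (length-filterᵇ κ ps) | sym (length-filterᵇ κ ms)
            | sym (length-filterᵇ (not ∘ κ) ps) | sym (length-filterᵇ (not ∘ κ) ms)
      = _ , _ , merge-↭ κ ps σ , merge-↭ κ ms τ ,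
        class-realizes (w * 10) _ _ (code-false κs κ ps hp) (code-false κs κ ms hm)
          (class-realizes (1 + w * 10) _ _ (code-true κs κ ps hp) (code-true κs κ ms hm) R′)

    co-plus : ∀ {κ κ′ : A → Bool} → (∀ r → κ′ r ≡ not (κ r)) → (R : Realizes κs st P M) →
      plusChoice κ′ R ≡ zipWith _∸_ (plusCounts st) (plusChoice κ R)
    co-plus h [] = refl
    co-plus {κ = κ} h (block ps ms _ _ R) =
      cong₂ _∷_ (trans (total-cong (cong bit ∘ h) ps) (cnt-not∸ κ ps)) (co-plus h R)

    co-minus : ∀ {κ κ′ : A → Bool} → (∀ r → κ′ r ≡ not (κ r)) → (R : Realizes κs st P M) →
      minusChoice κ′ R ≡ zipWith _∸_ (minusCounts st) (minusChoice κ R)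
    co-minus h [] = refl
    co-minus {κ = κ} h (block ps ms _ _ R) =
      cong₂ _∷_ (trans (total-cong (cong bit ∘ h) ms) (cnt-not∸ κ ms)) (co-minus h R)

    nonempty-∈ : (rs : List A) → T (not (length rs ≡ᵇ 0)) → ∃ (_∈ rs)
    nonempty-∈ (r ∷ rs) _ = r , here refl

    -- One block of each leg is taken from the class. The pair is fixed before `κ` is known, so that
    -- a column separating these two blocks can be chosen afterwards.
    mixed-sound : ∀ i {κs : List (A → Bool)} {st P M} (R : Realizes κs st P M) → T (isMixed i st) →
      ∃₂ λ p m → p ∈ P × m ∈ M × (∀ κ → T (unsplit i st (plusChoice κ R) (minusChoice κ R)) → κ p ≡ κ m)
    mixed-sound zero (block ps ms _ _ R) t
      with p , p∈ ← nonempty-∈ ps (proj₁ (T-∧⁻ t)) | m , m∈ ← nonempty-∈ ms (proj₂ (T-∧⁻ {not (length ps ≡ᵇ 0)} t))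
      = p , m , ∈-++⁺ˡ p∈ , ∈-++⁺ˡ m∈ , λ κ u → case κ (T-∨⁻ {(cnt κ ps ≡ᵇ 0) ∧ (cnt κ ms ≡ᵇ 0)} u)
      where
      case : ∀ κ → T ((cnt κ ps ≡ᵇ 0) ∧ (cnt κ ms ≡ᵇ 0)) ⊎ T ((cnt κ ps ≡ᵇ length ps) ∧ (cnt κ ms ≡ᵇ length ms)) →
          κ _ ≡ κ _
      case κ (inj₁ u) with up , um ← T-∧⁻ {cnt κ ps ≡ᵇ 0} u =
        trans (constant-∈ κ ps p∈ (≡ᵇ⇒≡ _ _ up)) (sym (constant-∈ κ ms m∈ (≡ᵇ⇒≡ _ _ um)))
      case κ (inj₂ u) with up , um ← T-∧⁻ {cnt κ ps ≡ᵇ length ps} u =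
        trans (constant-full κ ps p∈ (≡ᵇ⇒≡ _ _ up)) (sym (constant-full κ ms m∈ (≡ᵇ⇒≡ _ _ um)))
    mixed-sound (suc i) (block ps ms _ _ R) t with p , m , p∈ , m∈ , h ← mixed-sound i R t =
      p , m , ∈-++⁺ʳ ps p∈ , ∈-++⁺ʳ ms m∈ , h

    flat-block : ∀ (κ : A → Bool) ps → T ((cnt κ ps ≡ᵇ 0) ∨ (cnt κ ps ≡ᵇ length ps)) →
      map κ ps ≡ replicate (length ps) (not (cnt κ ps ≡ᵇ 0))
    flat-block κ [] t = refl
    -- Since `ps` is nonempty, a full count is a successor, and the flag computed from it is `true`.
    flat-block κ ps@(_ ∷ _) t with T-∨⁻ {cnt κ ps ≡ᵇ 0} t
    ... | inj₁ u with e ← ≡ᵇ⇒≡ (cnt κ ps) 0 u rewrite e = map-constant κ false ps (λ p → constant-∈ κ ps p e)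
    ... | inj₂ u with e ← ≡ᵇ⇒≡ (cnt κ ps) (length ps) u rewrite e = map-constant κ true ps
        (λ p → constant-full κ ps p e)

    flat-plus : ∀ (κ : A → Bool) (R : Realizes κs st P M) → T (steady (plusCounts st) (plusChoice κ R)) →
      map κ P ≡ flat (plusCounts st) (plusChoice κ R)
    flat-plus κ [] t = refl
    flat-plus κ (block ps ms _ _ R) t with u , t′ ← T-∧⁻ {(cnt κ ps ≡ᵇ 0) ∨ (cnt κ ps ≡ᵇ length ps)} t =
      trans (map-++ κ ps _) (cong₂ _++_ (flat-block κ ps u) (flat-plus κ R t′))

    flat-minus : ∀ (κ : A → Bool) (R : Realizes κs st P M) → T (steady (minusCounts st) (minusChoice κ R)) →
      map κ M ≡ flat (minusCounts st) (minusChoice κ R)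
    flat-minus κ [] t = refl
    flat-minus κ (block ps ms _ _ R) t with u , t′ ← T-∧⁻ {(cnt κ ms ≡ᵇ 0) ∨ (cnt κ ms ≡ᵇ length ms)} t =
      trans (map-++ κ ms _) (cong₂ _++_ (flat-block κ ms u) (flat-minus κ R t′))

    column-block : ∀ (κ : A → Bool) κs w rs → All (λ r → code (κ ∷ κs) r ≡ w) rs → map κ rs
        ≡ replicate (length rs) (w % 10 ≡ᵇ 1)
    column-block κ κs w rs h = map-constant κ _ rs λ p → step (All.lookup h p)
      where
      unbit : ∀ b → b ≡ (bit b ≡ᵇ 1)
      unbit false = refl
      unbit true = refl
      step : ∀ {r} → code (κ ∷ κs) r ≡ w → κ r ≡ (w % 10 ≡ᵇ 1)
      step {r} refl = trans (unbit (κ r)) (cong (_≡ᵇ 1) (sym (digit (κ r) (code κs r))))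

    column-plus : ∀ {κ : A → Bool} → Realizes (κ ∷ κs) st P M → map κ P ≡ column plusCounts st
    column-plus [] = refl
    column-plus {κs = κs} {κ = κ} (block {w} ps ms hp _ R) =
      trans (map-++ κ ps _) (cong₂ _++_ (column-block κ κs w ps hp) (column-plus R))

    column-minus : ∀ {κ : A → Bool} → Realizes (κ ∷ κs) st P M → map κ M ≡ column minusCounts st
    column-minus [] = refl
    column-minus {κs = κs} {κ = κ} (block {w} ps ms _ hm R) =
      trans (map-++ κ ms _) (cong₂ _++_ (column-block κ κs w ms hm) (column-minus R))

    older-realizes : ∀ {κ : A → Bool} → Realizes (κ ∷ κs) st P M → Realizes κs (older st) P M
    older-realizes [] = []
    older-realizes {κs = κs} {κ = κ} (block ps ms hp hm R) = block ps ms (All.map step hp) (All.map step hm)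
        (older-realizes R)
      where
      step : ∀ {r w} → code (κ ∷ κs) r ≡ w → code κs r ≡ w / 10
      step {r} refl = sym (shift-digit (κ r) (code κs r))

    columns-sound : ∀ (κs : List (A → Bool)) {st P M} → Realizes κs st P M →
      columnsOf (length κs) st ≡ map (λ κ → map κ P , map κ M) κs
    columns-sound [] R = refl
    columns-sound (κ ∷ κs) R =
      cong₂ _∷_ (cong₂ _,_ (sym (column-plus R)) (sym (column-minus R))) (columns-sound κs (older-realizes R))

  -- Columns of the elements of V, and fits to a form

  col : ∀ {n} → Fin n → Bool → Subset n → Bool
  col v b r = b xor lookup r v

  ∃-separating : ∀ {n} (p m : Subset n) → p ≢ m → ∃ λ v → lookup p v ≢ lookup m v
  ∃-separating [] [] p≢m = contradiction refl p≢m
  ∃-separating (b ∷ p) (c ∷ m) p≢m with b ≟ᵇ c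
  ... | no b≢c = zero , b≢c
  ... | yes refl with v , h ← ∃-separating p m (p≢m ∘ cong (b ∷_)) = suc v , h

  sequence : ∀ {n} {G : Set} {Q : Fin n → Set} → (∀ v → Q v ⊎ G) → (∀ v → Q v) ⊎ G
  sequence {zero} f = inj₁ λ ()
  sequence {suc n} f with f zero | sequence (f ∘ suc)
  ... | inj₂ g | _ = inj₂ g
  ... | inj₁ q | inj₂ g = inj₂ g
  ... | inj₁ q | inj₁ qs = inj₁ λ { zero → q ; (suc v) → qs v }

  xor-cancelˡ : ∀ b c → b xor (b xor c) ≡ c
  xor-cancelˡ b c = trans (sym (xor-assoc b b c)) (cong (_xor c) (xor-same b))

  xor-injective : ∀ b {c d} → b xor c ≡ b xor d → c ≡ d
  xor-injective b {c} {d} e = trans (sym (xor-cancelˡ b c)) (trans (cong (b xor_) e) (xor-cancelˡ b d))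

  values-xor : ∀ b c ms e → map (b xor_) (values c ms e) ≡ values (b xor c) ms e
  values-xor b c [] e = refl
  values-xor b c (m ∷ ms) e = cong₂ _∷_ (sym (xor-assoc b c _)) (values-xor b c ms e)

  -- Complemented columns are included, as the search chooses between a column and its complement.
  -- The case of twice the same column says that it has equally many ones in both legs.
  Balanced : ∀ {n} → List (Subset n) → List (Subset n) → Set
  Balanced P M = ∀ u b v c → cnt (λ r → col u b r ∧ col v c r) P ≡ cnt (λ r → col u b r ∧ col v c r) M

  -- `flips` will become the set of the shift, and the `i`-th parameter set will consist of the
  -- elements `v` for which `params v` contains `i`.
  record Fit {n} (P₀ M₀ : List (Subset n)) : Set where
    field
      index : Fin 4
    F : Shape
    F = lookup shapes index
    field
      P M : List (Subset n)
      P↭P₀ : P ↭ P₀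
      M↭M₀ : M ↭ M₀
      flips : Fin n → Bool
      params : Fin n → Subset 7
      params∈table : ∀ v → params v ∈ table F
      plus≡ : ∀ v → map (λ r → lookup r v) P ≡ values (flips v) (plus F) (params v)
      minus≡ : ∀ v → map (λ r → lookup r v) M ≡ values (flips v) (minus F) (params v)
      realized : ∀ {t} → t ∈ tests F → ∃ λ v → T (t (params v))

  entriesOn-sound : ∀ F es {q} → q ∈ entriesOn F es → ∃₂ λ b e → e ∈ es × q ≡ entry F b e
  entriesOn-sound F es q∈ with ∈-++⁻ (map (entry F false) es) q∈
  ... | inj₁ p with e , e∈ , refl ← ∈-map⁻ (entry F false) p = false , e , e∈ , refl
  ... | inj₂ p with e , e∈ , refl ← ∈-map⁻ (entry F true) p = true , e , e∈ , refl

  entry∈entriesOn : ∀ F es b {e} → e ∈ es → entry F b e ∈ entriesOn F es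
  entry∈entriesOn F es false p = ∈-++⁺ˡ (∈-map⁺ (entry F false) p)
  entry∈entriesOn F es true p = ∈-++⁺ʳ (map (entry F false) es) (∈-map⁺ (entry F true) p)

  -- Soundness of the search

  module Soundness {n} (P₀ M₀ : List (Subset n)) (balanced : Balanced P₀ M₀)
    (apart : ∀ {p m} → p ∈ P₀ → m ∈ M₀ → p ≢ m) (small : length P₀ ≤ 7) where

    Goal : Set
    Goal = Fit P₀ M₀

    Column : (Subset n → Bool) → Set
    Column κ = ∃₂ λ v b → ∀ r → κ r ≡ col v b r

    -- The quantification over all columns and all orders of the blocks lets a node that was checked
    -- once serve wherever its state turns up.
    Good : Node → Set
    Good (d , st) = ∀ κs {P M} → All Column κs → length κs ≡ d → P ↭ P₀ → M ↭ M₀ → Realizes κs st P M → Goal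

    AllGood : List Known → Set
    AllGood = All (Good ∘ proj₂)

    both : (κ κ′ : Subset n → Bool) → Subset n → Bool
    both κ κ′ r = κ r ∧ κ′ r

    balanced-columns : ∀ {κ κ′} → Column κ → Column κ′ → cnt (both κ κ′) P₀ ≡ cnt (both κ κ′) M₀
    balanced-columns (v , b , h) (u , c , k) =
      trans (total-cong eq P₀) (trans (balanced v b u c) (sym (total-cong eq M₀)))
      where eq = λ r → cong bit (cong₂ _∧_ (h r) (k r))

    total-+* : ∀ (f g : Subset n → ℕ) rs → total (λ r → f r + g r * 10) rs ≡ total f rs + total g rs * 10
    total-+* f g [] = refl
    total-+* f g (r ∷ rs) rewrite total-+* f g rs | *-distribʳ-+ 10 (g r) (total g rs) = interchange (f r)
        (g r * 10) (total f rs) (total g rs * 10)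
      where
      interchange : ∀ a b c d → (a + b) + (c + d) ≡ (a + c) + (b + d)
      interchange a b c d = trans (+-assoc a b (c + d)) (trans (cong (_+_ a) (trans (sym (+-assoc b c d))
        (trans (cong (_+ d) (+-comm b c)) (+-assoc c b d)))) (sym (+-assoc a c (b + d))))

    bit-both : ∀ b c → bit b * bit c ≡ bit (b ∧ c)
    bit-both false c = refl
    bit-both true c = +-identityʳ (bit c)

    -- The sum is a combination of powers of ten whose coefficients count the common ones of `κ`
    -- with each chosen column. The leading digit 1 of the codes contributes the size of `κ`, that
    -- is, the balance of `κ` with itself. Balance makes the two legs agree coefficient by
    -- coefficient.
    balanced-codes : ∀ {κ} → Column κ → ∀ {κs} → All Column κs →
      total (λ r → bit (κ r) * code κs r) P₀ ≡ total (λ r → bit (κ r) * code κs r) M₀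
    balanced-codes {κ} k [] = trans (step P₀) (trans (balanced-columns k k) (sym (step M₀)))
      where
      idem : ∀ b → bit b * 1 ≡ bit (b ∧ b)
      idem false = refl
      idem true = refl
      step = total-cong (λ r → idem (κ r))
    balanced-codes {κ} k {κ′ ∷ κs} (k′ ∷ ks) =
      trans (step P₀) (trans (cong₂ (λ a b → a + b * 10) (balanced-columns k k′) (balanced-codes k ks))
          (sym (step M₀)))
      where
      step : ∀ rs → total (λ r → bit (κ r) * code (κ′ ∷ κs) r) rs ≡
        cnt (both κ κ′) rs + total (λ r → bit (κ r) * code κs r) rs * 10
      step rs = trans (total-cong (λ r → trans (*-distribˡ-+ (bit (κ r)) (bit (κ′ r)) (code κs r * 10))
        (cong₂ _+_ (bit-both (κ r) (κ′ r)) (sym (*-assoc (bit (κ r)) (code κs r) 10)))) rs)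
        (total-+* (bit ∘ both κ κ′) (λ r → bit (κ r) * code κs r) rs)

    -- Otherwise a column and its complement would together have 8 ones among at most 7 blocks.
    light : ∀ v → ∃ λ b → cnt (col v b) P₀ < 4
    light v with cnt (col v false) P₀ <? 4
    ... | yes h = false , h
    ... | no h = true , ≰⇒> λ h′ → <⇒≱ (s≤s small) (subst (8 ≤_) (cnt-not (col v false) P₀) (+-mono-≤ h′ (≮⇒≥ h)))

    module _ {d st κs P M} (columns : All Column κs) (depth : length κs ≡ d) (σ : P ↭ P₀) (τ : M ↭ M₀)
      (R : Realizes κs st P M) where

      allBalanced-column : ∀ ok → T (allBalanced ok st) → ∀ v b → cnt (col v b) P₀ < 4 →
        T (ok (plusChoice (col v b) R) (minusChoice (col v b) R))
      allBalanced-column ok t v b c<4 = allBalanced-sound ok st t c<4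
        (subst (λ c → plusChoice κ R ∈ choices (plusCounts st) c) (total-↭ (bit ∘ κ) σ) (plus∈choices κ R))
        (subst (λ c → minusChoice κ R ∈ choices (minusCounts st) c)
          -- Balance of the column with itself moves the count from T₋ to T₊.
          (trans (total-↭ (bit ∘ κ) τ) (sym (trans (sym (idem P₀)) (trans (balanced v b v b) (idem M₀)))))
              (minus∈choices κ R))
        (trans (weight-plus κ R) (trans (total-↭ _ σ) (trans (balanced-codes k columns)
          (trans (sym (total-↭ _ τ)) (sym (weight-minus κ R))))))
        where
        κ = col v b
        k : Column κ
        k = v , b , λ _ → refl
        ∧-same : ∀ b → b ∧ b ≡ b
        ∧-same false = refl
        ∧-same true = refl
        idem = total-cong (λ r → cong bit (∧-same (κ r)))

      continue : ∀ {Γ} → AllGood Γ → ∀ κ → Column κ →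
        (let s = split st (plusChoice κ R) (minusChoice κ R)) → T (member Γ (fingerprint s) (suc d , s)) → Goal
      continue {Γ} good κ k t with _ , s∈ ← member-sound Γ _ _ t | P′ , M′ , σ′ , τ′ , R′ ← split-realizes κ R =
        All.lookup good s∈ (κ ∷ κs) (k ∷ columns) (cong suc depth) (↭-trans σ′ σ) (↭-trans τ′ τ) R′

      known-sound : ∀ {Γ} → AllGood Γ → ∀ v b → T (known Γ (d , st) (plusChoice (col v b) R)
          (minusChoice (col v b) R)) → Goal
      known-sound {Γ} good v b t with T-∨⁻ {member Γ _ _} t
      ... | inj₁ u = continue good (col v b) (v , b , λ _ → refl) u
      ... | inj₂ u = continue good (col v (not b)) (v , not b , λ _ → refl)
        (subst₂ (λ ks ls → T (member Γ (fingerprint (split st ks ls)) (suc d , split st ks ls)))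
            (sym (co-plus flip R)) (sym (co-minus flip R)) u)
        where
        flip : ∀ r → col v (not b) r ≡ not (col v b r)
        flip r = sym (not-distribˡ-xor b (lookup r v))

      -- Blocks of different legs differ as sets, so some element of V separates the two blocks of
      -- the mixed class. Its light column does not leave the class unsplit, hence it leads to a
      -- node already known to be good.
      follows-mixed : ∀ {Γ} → AllGood Γ → ∀ i → T (follows catalogue Γ (d , st) (mixed i)) → Goal
      follows-mixed good i t
        with t₁ , t₂ ← T-∧⁻ {isMixed i st} t
        with p , m , p∈ , m∈ , h ← mixed-sound i R t₁
        with v , v-sep ← ∃-separating p m (apart (∈-resp-↭ σ p∈) (∈-resp-↭ τ m∈))
        with b , b<4 ← light v
        with T-∨⁻ {unsplit i st _ _} (allBalanced-column _ t₂ v b b<4)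
      ... | inj₁ u = contradiction (xor-injective b (h (col v b) u)) v-sep
      ... | inj₂ u = known-sound good v b u

      module Placement {Γ} (good : AllGood Γ) (S : Shape) (es : List (Subset 7)) (ts : List (Subset 7 → Bool))
          (π ρ : List ℕ) where

        Placed : Fin n → Set
        Placed v = ∃₂ λ b e → e ∈ es ×
          map (λ r → lookup r v) (arrange π P) ≡ values b (plus S) e ×
          map (λ r → lookup r v) (arrange ρ M) ≡ values b (minus S) e

        uncol : ∀ (v : Fin n) b (rs : List (Subset n)) {vs} → map (col v b) rs ≡ vs → map (λ r → lookup r v) rs
            ≡ map (b xor_) vs
        uncol v b rs refl = trans (map-cong (λ r → sym (xor-cancelˡ b (lookup r v))) rs) (map-∘ rs)

        fits? : List ℕ → List ℕ → Bool
        fits? ks ls = steady (plusCounts st) ks ∧ steady (minusCounts st) ls ∧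
          any (matches (arrange π (flat (plusCounts st) ks)) (arrange ρ (flat (minusCounts st) ls))) (entriesOn S es)

        placing : Fin n → Bool → Bool
        placing v b = fits? (plusChoice (col v b) R) (minusChoice (col v b) R)

        place : ∀ v b → T (placing v b) → Placed v
        place v b t
          with t₁ , t′ ← T-∧⁻ {steady (plusCounts st) (plusChoice (col v b) R)} t
          with t₂ , t₃ ← T-∧⁻ {steady (minusCounts st) (minusChoice (col v b) R)} t′
          with q , q∈ , h ← find (any⁻ _ (entriesOn S es) t₃)
          with c , e , e∈ , refl ← entriesOn-sound S es q∈
          with hp , hm ← T-∧⁻ {same (arrange π (flat (plusCounts st) (plusChoice (col v b) R))) _} h
          -- The column complemented by `b` matches an entry with flag `c`; undoing `b` leaves the
          -- flag `b xor c`.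
          = b xor c , e , e∈ ,
            trans (uncol v b (arrange π P) (trans (arrange-map (col v b) π P)
              (trans (cong (arrange π) (flat-plus (col v b) R t₁)) (same-sound _ _ hp))))
                  (values-xor b c (plus S) e) ,
            trans (uncol v b (arrange ρ M) (trans (arrange-map (col v b) ρ M)
              (trans (cong (arrange ρ) (flat-minus (col v b) R t₂)) (same-sound _ _ hm))))
                  (values-xor b c (minus S) e)

        realizing : ∀ {t} → T (any (all t) (map (candidates π ρ (entriesOn S es)) (columnsOf d st))) →
          ∃ λ κ → κ ∈ κs × T (all t (candidates π ρ (entriesOn S es) (map κ P , map κ M)))
        realizing {t} h
          with cs , cs∈ , u ← find (any⁻ (all t) _ h)
          with pm , pm∈ , refl ← ∈-map⁻ (candidates π ρ (entriesOn S es)) cs∈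
          with κ , κ∈ , refl ← ∈-map⁻ (λ κ → map κ P , map κ M)
                 (subst (pm ∈_) (trans (cong (λ d → columnsOf d st) (sym depth)) (columns-sound κs R)) pm∈)
          = κ , κ∈ , u

        recol : ∀ {κ} {v : Fin n} b c ms e → (∀ r → κ r ≡ col v b r) → ∀ θ rs →
          map (λ r → lookup r v) (arrange θ rs) ≡ values c ms e → arrange θ (map κ rs) ≡ values (b xor c) ms e
        recol {κ} {v} b c ms e k θ rs eq = trans (sym (arrange-map κ θ rs)) (trans (map-cong k (arrange θ rs))
          (trans (map-∘ (arrange θ rs)) (trans (cong (map (b xor_)) eq) (values-xor b c ms e))))

        witness : (placed : ∀ v → Placed v) → ∀ {t} →
          T (any (all t) (map (candidates π ρ (entriesOn S es)) (columnsOf d st))) →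
              ∃ λ v → T (t (proj₁ (proj₂ (placed v))))
        witness placed {t} h
          with κ , κ∈ , h′ ← realizing {t} h
          with v , b , k ← All.lookup columns κ∈
          = v , All.lookup (all⁺ t _ h′) (∈-map⁺ proj₁ (∈-filter⁺
              (T? ∘ matches (arrange π (map κ P)) (arrange ρ (map κ M)))
              (entry∈entriesOn S es (b xor c) e∈)
              (Equivalence.from T-∧
                (subst (λ x → T (same x (values (b xor c) (plus S) e))) (sym (recol b c (plus S) e k π P p≡))
                    (same-refl (values (b xor c) (plus S) e)) ,
                 subst (λ x → T (same x (values (b xor c) (minus S) e))) (sym (recol b c (minus S) e k ρ M m≡))
                     (same-refl (values (b xor c) (minus S) e))))))
          where
          c = proj₁ (placed v)
          e = proj₁ (proj₂ (placed v))
          e∈ = proj₁ (proj₂ (proj₂ (placed v)))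
          p≡ = proj₁ (proj₂ (proj₂ (proj₂ (placed v))))
          m≡ = proj₂ (proj₂ (proj₂ (proj₂ (placed v))))

        follows-fits : T (fitsWith Γ (d , st) π ρ (ts , entriesOn S es)) →
          (Σ (∀ v → Placed v) λ placed → ∀ {t} → t ∈ ts → ∃ λ v → T (t (proj₁ (proj₂ (placed v))))) ⊎ Goal
        follows-fits t with t₁ , t₂ ← T-∧⁻ {allRealized (map (candidates π ρ (entriesOn S es)) (columnsOf d st)) ts} t
          -- Each element of V either has its column in the table or leads to a known node; a single
          -- element of the second kind already gives a fit.
          with sequence (λ v → let b , b<4 = light v in
            [ inj₁ ∘ place v b , inj₂ ∘ known-sound good v b ]′
              (T-∨⁻ {placing v b} (allBalanced-column (λ ks ls → fits? ks ls ∨ known Γ (d , st) ks ls) t₂ v b b<4)))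
        ... | inj₂ g = inj₂ g
        ... | inj₁ placed = inj₁ (placed , λ {t} t∈ → witness placed {t} (All.lookup (all⁺ _ ts t₁) t∈))

      fit-from : ∀ {Γ} → AllGood Γ → ∀ i π ρ → T (fitsWith Γ (d , st) π ρ
          (tests (lookup shapes i) , entries (lookup shapes i))) → Goal
      fit-from good i π ρ t with Placement.follows-fits good (lookup shapes i) (table (lookup shapes i))
          (tests (lookup shapes i)) π ρ t
      ... | inj₂ g = g
      ... | inj₁ (placed , witnessed) = record
          { index = i
          ; P = arrange π P
          ; M = arrange ρ M
          ; P↭P₀ = ↭-trans (arrange-↭ π P) σ
          ; M↭M₀ = ↭-trans (arrange-↭ ρ M) τ
          ; flips = λ v → proj₁ (placed v)
          ; params = λ v → proj₁ (proj₂ (placed v))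
          ; params∈table = λ v → proj₁ (proj₂ (proj₂ (placed v)))
          ; plus≡ = λ v → proj₁ (proj₂ (proj₂ (proj₂ (placed v))))
          ; minus≡ = λ v → proj₂ (proj₂ (proj₂ (proj₂ (placed v))))
          ; realized = witnessed
          }

    follows-sound : ∀ {Γ} → AllGood Γ → ∀ s r → T (follows catalogue Γ s r) → Good s
    follows-sound good (d , st) (mixed i) t κs k depth σ τ R = follows-mixed k depth σ τ R good i t
    follows-sound {Γ} good (d , st) (fits i π ρ) t κs k depth σ τ R = fit-from k depth σ τ R good i π ρ
      (subst (λ c → T (fitsWith Γ (d , st) π ρ c)) (lookup-map i (λ F → tests F , entries F) shapes) t)

    -- The order of the certificate is the induction: a node refers only to earlier nodes, which are
    -- good by then.
    valid-sound : ∀ {root Γ} → AllGood Γ → ∀ cs → T (valid catalogue root Γ cs) → Good root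
    valid-sound {root} {Γ} good [] t with (_ , s) , s∈ ,
        h ← find (any⁻ _ Γ t) = subst Good (sameNode-sound s root h) (All.lookup good s∈)
    valid-sound {root} {Γ} good ((s , r) ∷ cs) t with t₁ , t₂ ← T-∧⁻ {follows catalogue Γ s r} t =
      valid-sound (follows-sound good s r t₁ ∷ good) cs t₂

    root : Node
    root = 0 , (1 , length P₀ , length M₀) ∷ []

    fit : ∀ cs → T (valid catalogue root [] cs) → Goal
    fit cs t = valid-sound [] cs t [] [] refl (↭-reflexive (++-identityʳ P₀)) (↭-reflexive (++-identityʳ M₀))
      (block P₀ M₀ (All.tabulate λ _ → refl) (All.tabulate λ _ → refl) [])

module Trades where

  open Classification
  open Shape
  open import Data.Integer using (ℤ; -[1+_]; -_; _+_; _-_; _*_; _⊔_)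
  open import Data.Integer.Properties as ℤₚ using (+-identityˡ; +-identityʳ; *-identityˡ; *-zeroˡ)
  open import Data.Integer.Tactic.RingSolver using (solve-∀)
  open import Data.Nat as ℕ using (zero; suc; z≤n; s≤s)
  import Data.Nat.Properties as ℕₚ

  -- Symmetric differences and sums over the power set

  ⊕-comm : ∀ {n} (X Y : Subset n) → X ⊕ Y ≡ Y ⊕ X
  ⊕-comm = zipWith-comm xor-comm

  ⊕-assoc : ∀ {n} (X Y Z : Subset n) → X ⊕ Y ⊕ Z ≡ X ⊕ (Y ⊕ Z)
  ⊕-assoc = zipWith-assoc xor-assoc

  ⊕-same : ∀ {n} (X : Subset n) → X ⊕ X ≡ ∅
  ⊕-same [] = refl
  ⊕-same (b ∷ X) = cong₂ _∷_ (xor-same b) (⊕-same X)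

  ⊕-identityˡ : ∀ {n} (X : Subset n) → ∅ ⊕ X ≡ X
  ⊕-identityˡ [] = refl
  ⊕-identityˡ (b ∷ X) = cong (b ∷_) (⊕-identityˡ X)

  ⊕-cancelˡ : ∀ {n} (X Y : Subset n) → X ⊕ (X ⊕ Y) ≡ Y
  ⊕-cancelˡ X Y = trans (sym (⊕-assoc X X Y)) (trans (cong (_⊕ Y) (⊕-same X)) (⊕-identityˡ Y))

  sumℤ-++ : ∀ xs ys → sumℤ (xs ++ ys) ≡ sumℤ xs + sumℤ ys
  sumℤ-++ [] ys = sym (+-identityˡ (sumℤ ys))
  sumℤ-++ (x ∷ xs) ys = trans (cong (λ s → x + s) (sumℤ-++ xs ys)) (sym (ℤₚ.+-assoc x (sumℤ xs) (sumℤ ys)))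

  sumℤ-map-- : ∀ {A : Set} (f g : A → ℤ) xs → sumℤ (map (λ a → f a - g a) xs) ≡ sumℤ (map f xs) - sumℤ (map g xs)
  sumℤ-map-- f g [] = refl
  sumℤ-map-- f g (a ∷ xs) = trans (cong (λ s → f a - g a + s) (sumℤ-map-- f g xs)) (interchange (f a) (g a) _ _)
    where
    interchange : ∀ a b c d → a - b + (c - d) ≡ a + c - (b + d)
    interchange = solve-∀

  ∑ : ∀ {n} → GR n → ℤ
  ∑ {n} f = sumℤ (map f (allSubsets n))

  ∑-cong : ∀ {n} {f g : GR n} → f ≐ g → ∑ f ≡ ∑ g
  ∑-cong {n} h = cong sumℤ (map-cong h (allSubsets n))

  ∑-- : ∀ {n} (f g : GR n) → ∑ (f -ᵍ g) ≡ ∑ f - ∑ g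
  ∑-- {n} f g = sumℤ-map-- f g (allSubsets n)

  ∑-suc : ∀ {n} (f : GR (suc n)) → ∑ f ≡ ∑ (f ∘ (false ∷_)) + ∑ (f ∘ (true ∷_))
  ∑-suc {n} f = trans (cong sumℤ (map-++ f (map (false ∷_) (allSubsets n)) _))
    (trans (sumℤ-++ (map f (map (false ∷_) (allSubsets n))) _)
      (cong₂ _+_ (cong sumℤ (sym (map-∘ (allSubsets n)))) (cong sumℤ (sym (map-∘ (allSubsets n))))))

  ∑-⊕ : ∀ {n} W (f : GR n) → ∑ (λ X → f (W ⊕ X)) ≡ ∑ f
  ∑-⊕ [] f = refl
  ∑-⊕ (false ∷ W) f = trans (∑-suc (λ X → f ((false ∷ W) ⊕ X)))
    (trans (cong₂ _+_ (∑-⊕ W (f ∘ (false ∷_))) (∑-⊕ W (f ∘ (true ∷_)))) (sym (∑-suc f)))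
  ∑-⊕ (true ∷ W) f = trans (∑-suc (λ X → f ((true ∷ W) ⊕ X)))
    (trans (cong₂ _+_ (∑-⊕ W (f ∘ (true ∷_))) (∑-⊕ W (f ∘ (false ∷_))))
      (trans (ℤₚ.+-comm (∑ (f ∘ (true ∷_))) _) (sym (∑-suc f))))

  ∑-zero : ∀ {n} (f : GR n) → (∀ X → f X ≡ + 0) → ∑ f ≡ + 0
  ∑-zero {n} f h = go (allSubsets n)
    where
    go : ∀ Xs → sumℤ (map f Xs) ≡ + 0
    go [] = refl
    go (X ∷ Xs) = cong₂ _+_ (h X) (go Xs)

  ⟦⟧-yes : ∀ {n} (X : Subset n) → ⟦ X ⟧ X ≡ + 1
  ⟦⟧-yes X with X ≟ˢ X
  ... | yes _ = refl
  ... | no ¬e = contradiction refl ¬e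

  ⟦⟧-no : ∀ {n} {X Y : Subset n} → X ≢ Y → ⟦ X ⟧ Y ≡ + 0
  ⟦⟧-no {X = X} {Y} ¬e with X ≟ˢ Y
  ... | yes e = contradiction e ¬e
  ... | no _ = refl

  ⟦⟧-iff : ∀ {m n} {X Y : Subset m} {X′ Y′ : Subset n} → (X ≡ Y → X′ ≡ Y′) → (X′ ≡ Y′ → X ≡ Y) → ⟦ X ⟧ Y ≡ ⟦ X′ ⟧ Y′
  ⟦⟧-iff {X = X} {Y} {X′} {Y′} to from with X ≟ˢ Y | X′ ≟ˢ Y′
  ... | yes _ | yes _ = refl
  ... | yes e | no ¬e = contradiction (to e) ¬e
  ... | no ¬e | yes e = contradiction (from e) ¬e
  ... | no _ | no _ = refl

  ∑-δ : ∀ {n} (A : Subset n) (f : GR n) → ∑ (λ X → ⟦ A ⟧ X * f X) ≡ f A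
  ∑-δ [] f = trans (+-identityʳ (+ 1 * f [])) (*-identityˡ (f []))
  ∑-δ {suc n} (b ∷ A) f = trans (∑-suc (λ X → ⟦ b ∷ A ⟧ X * f X)) (step b)
    where
    hit : ∀ b → ∑ (λ X → ⟦ b ∷ A ⟧ (b ∷ X) * f (b ∷ X)) ≡ f (b ∷ A)
    hit b = trans (∑-cong λ X → cong (_* f (b ∷ X)) (⟦⟧-iff {X = b ∷ A} {b ∷ X} {A} {X} ∷-injectiveʳ
        (cong (b ∷_)))) (∑-δ A (f ∘ (b ∷_)))
    miss : ∀ {b c} → b ≢ c → ∑ (λ X → ⟦ b ∷ A ⟧ (c ∷ X) * f (c ∷ X)) ≡ + 0
    miss {b} {c} b≢c = ∑-zero _ λ X → trans (cong (_* f (c ∷ X))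
        (⟦⟧-no {X = b ∷ A} {c ∷ X} (λ { refl → b≢c refl }))) (*-zeroˡ (f (c ∷ X)))
    step : ∀ b → ∑ (λ X → ⟦ b ∷ A ⟧ (false ∷ X) * f (false ∷ X)) + ∑ (λ X → ⟦ b ∷ A ⟧ (true ∷ X) * f (true ∷ X))
        ≡ f (b ∷ A)
    step false = trans (cong₂ _+_ (hit false) (miss {false} {true} λ ())) (+-identityʳ _)
    step true = trans (cong₂ _+_ (miss {true} {false} λ ()) (hit true)) (+-identityˡ _)

  -- Trades as functions orthogonal to all pairs of columns

  ι : Bool → ℤ
  ι false = + 0
  ι true = + 1

  _·_ : ∀ {n} → GR n → (Subset n → Bool) → ℤ
  T · κ = ∑ (λ X → T X * ι (κ X))

  ·-cong : ∀ {n} (T : GR n) {κ κ′} → (∀ X → κ X ≡ κ′ X) → T · κ ≡ T · κ′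
  ·-cong T h = ∑-cong λ X → cong (λ b → T X * ι b) (h X)

  blocksContaining-· : ∀ {n} (T : GR n) S → blocksContaining T S ≡ T · (λ X → does (S ⊆? X))
  blocksContaining-· {n} T S = go (allSubsets n)
    where
    go : ∀ Xs → sumℤ (map T (filter (S ⊆?_) Xs)) ≡ sumℤ (map (λ X → T X * ι (does (S ⊆? X))) Xs)
    go [] = refl
    go (X ∷ Xs) with does (S ⊆? X)
    ... | true = cong₂ _+_ (sym (ℤₚ.*-identityʳ (T X))) (go Xs)
    ... | false = trans (go Xs) (trans (sym (+-identityˡ _)) (cong (_+ _) (sym (ℤₚ.*-zeroʳ (T X)))))

  ∅⊆? : ∀ {n} (X : Subset n) → does (∅ ⊆? X) ≡ true
  ∅⊆? X = dec-true (∅ ⊆? X) ⊥⊆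

  pair⊆? : ∀ {n} (u v : Fin n) X → does (⁅ u ⁆ ∪ ⁅ v ⁆ ⊆? X) ≡ lookup X u ∧ lookup X v
  pair⊆? u v X with lookup X u in eu | lookup X v in ev
  ... | true | true = dec-true (_ ⊆? X) λ {w} w∈ → covered (x∈p∪q⁻ ⁅ u ⁆ ⁅ v ⁆ w∈)
    where
    covered : ∀ {w} → w S.∈ ⁅ u ⁆ ⊎ w S.∈ ⁅ v ⁆ → w S.∈ X
    covered (inj₁ p) rewrite x∈⁅y⁆⇒x≡y u p = lookup⇒[]= u X eu
    covered (inj₂ p) rewrite x∈⁅y⁆⇒x≡y v p = lookup⇒[]= v X ev
  ... | false | _ = dec-false (_ ⊆? X) λ h → case (trans (sym eu) ([]=⇒lookup (h (p⊆p∪q ⁅ v ⁆ (x∈⁅x⁆ u)))))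
    where case : false ≢ true
          case ()
  ... | true | false = dec-false (_ ⊆? X) λ h → case (trans (sym ev) ([]=⇒lookup (h (q⊆p∪q ⁅ u ⁆ ⁅ v ⁆ (x∈⁅x⁆ v)))))
    where case : false ≢ true
          case ()

  ∣p∪q∣≤∣p∣+∣q∣ : ∀ {n} (p q : Subset n) → ∣ p ∪ q ∣ ℕ.≤ ∣ p ∣ ℕ.+ ∣ q ∣
  ∣p∪q∣≤∣p∣+∣q∣ [] [] = z≤n
  ∣p∪q∣≤∣p∣+∣q∣ (false ∷ p) (false ∷ q) = ∣p∪q∣≤∣p∣+∣q∣ p q
  ∣p∪q∣≤∣p∣+∣q∣ (false ∷ p) (true ∷ q) = ℕₚ.≤-trans (s≤s (∣p∪q∣≤∣p∣+∣q∣ p q))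
      (ℕₚ.≤-reflexive (sym (ℕₚ.+-suc ∣ p ∣ ∣ q ∣)))
  ∣p∪q∣≤∣p∣+∣q∣ (true ∷ p) (false ∷ q) = s≤s (∣p∪q∣≤∣p∣+∣q∣ p q)
  ∣p∪q∣≤∣p∣+∣q∣ (true ∷ p) (true ∷ q) = s≤s (ℕₚ.≤-trans (∣p∪q∣≤∣p∣+∣q∣ p q) (ℕₚ.+-monoʳ-≤ ∣ p ∣ (ℕₚ.n≤1+n ∣ q ∣)))

  size-0 : ∀ {n} (S : Subset n) → ∣ S ∣ ℕ.≤ 0 → S ≡ ∅
  size-0 [] _ = refl
  size-0 (false ∷ S) h = cong (false ∷_) (size-0 S h)

  size-1 : ∀ {n} (S : Subset n) → ∣ S ∣ ℕ.≤ 1 → S ≡ ∅ ⊎ ∃ λ u → S ≡ ⁅ u ⁆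
  size-1 [] _ = inj₁ refl
  size-1 (true ∷ S) (s≤s h) = inj₂ (zero , cong (true ∷_) (size-0 S h))
  size-1 (false ∷ S) h with size-1 S h
  ... | inj₁ refl = inj₁ refl
  ... | inj₂ (u , refl) = inj₂ (suc u , refl)

  size-2 : ∀ {n} (S : Subset n) → ∣ S ∣ ℕ.≤ 2 → S ≡ ∅ ⊎ ∃₂ λ u v → S ≡ ⁅ u ⁆ ∪ ⁅ v ⁆
  size-2 [] _ = inj₁ refl
  size-2 (true ∷ S) (s≤s h) with size-1 S h
  ... | inj₁ refl = inj₂ (zero , zero , cong (true ∷_) (sym (∪-idem ∅)))
  ... | inj₂ (u , refl) = inj₂ (zero , suc u , cong (true ∷_) (sym (∪-identityˡ ⁅ u ⁆)))
  size-2 (false ∷ S) h with size-2 S h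
  ... | inj₁ refl = inj₁ refl
  ... | inj₂ (u , v , refl) = inj₂ (suc u , suc v , refl)

  -- A version of `IsTrade 2` that includes complemented columns. A shift by `W` only changes the
  -- flags at the elements of `W`, so invariance under shifts is immediate here.
  PairFree : ∀ {n} → GR n → Set
  PairFree T = ∑ T ≡ + 0 × (∀ u b v c → T · (λ X → col u b X ∧ col v c X) ≡ + 0)

  ·-true : ∀ {n} (T : GR n) → T · (λ _ → true) ≡ ∑ T
  ·-true T = ∑-cong (λ X → ℤₚ.*-identityʳ (T X))

  -- Inclusion and exclusion: complementing one column of a pair subtracts the pair from the other
  -- column alone, and complementing a single column subtracts it from the constant function. All
  -- these terms vanish for sets of size at most 2.
  trade⇒pairFree : ∀ {n} {T : GR n} → IsTrade 2 T → PairFree T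
  trade⇒pairFree {n} {T} trade = zero₀ , pairs
    where
    zero₀ : ∑ T ≡ + 0
    zero₀ = trans (sym (trans (blocksContaining-· T ∅) (trans (·-cong T ∅⊆?) (·-true T)))) (trade 0 z≤n ∅ (∣⊥∣≡0 n))
    zero₂ : ∀ u v → T · (λ X → lookup X u ∧ lookup X v) ≡ + 0
    zero₂ u v = trans (sym (trans (blocksContaining-· T (⁅ u ⁆ ∪ ⁅ v ⁆)) (·-cong T (pair⊆? u v))))
      (trade _ (ℕₚ.≤-trans (∣p∪q∣≤∣p∣+∣q∣ ⁅ u ⁆ ⁅ v ⁆) (ℕₚ.≤-reflexive (cong₂ ℕ._+_ (∣⁅x⁆∣≡1 u) (∣⁅x⁆∣≡1 v)))) _ refl)
    complement : ∀ {κ κ′ κ″} → T · κ ≡ + 0 → T · κ′ ≡ + 0 → (∀ X → ι (κ″ X) ≡ ι (κ X) - ι (κ′ X)) → T · κ″ ≡ + 0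
    complement {κ} {κ′} {κ″} e e′ h = trans (∑-cong λ X → trans (cong (T X *_) (h X))
        (distrib (T X) (ι (κ X)) (ι (κ′ X))))
      (trans (∑-- (λ X → T X * ι (κ X)) (λ X → T X * ι (κ′ X))) (cong₂ _-_ e e′))
      where
      distrib : ∀ a b c → a * (b - c) ≡ a * b - a * c
      distrib = solve-∀
    right : ∀ u v b → T · (λ X → lookup X u ∧ col v b X) ≡ + 0
    right u v false = zero₂ u v
    -- The column of `u` alone is written as the pair of `u` with itself, so that `zero₂` covers it.
    right u v true = complement {λ X → lookup X u ∧ lookup X u} {λ X → lookup X u ∧ lookup X v} (zero₂ u u)
        (zero₂ u v) (λ X → expansion (lookup X u) (lookup X v))
      where
      expansion : ∀ a b → ι (a ∧ not b) ≡ ι (a ∧ a) - ι (a ∧ b)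
      expansion false b = refl
      expansion true false = refl
      expansion true true = refl
    single : ∀ v c → T · col v c ≡ + 0
    single v false = trans (·-cong T λ X → sym (idem (lookup X v))) (zero₂ v v)
      where
      idem : ∀ b → b ∧ b ≡ b
      idem false = refl
      idem true = refl
    single v true = complement {λ _ → true} {col v false} (trans (·-true T) zero₀) (single v false)
        (λ X → expansion (lookup X v))
      where
      expansion : ∀ b → ι (not b) ≡ + 1 - ι b
      expansion false = refl
      expansion true = refl
    pairs : ∀ u b v c → T · (λ X → col u b X ∧ col v c X) ≡ + 0
    pairs u false v c = right u v c
    pairs u true v c = complement {col v c} {λ X → lookup X u ∧ col v c X} (single v c) (right u v c)
        (λ X → expansion (lookup X u) (col v c X))
      where
      expansion : ∀ a b → ι (not a ∧ b) ≡ ι b - ι (a ∧ b)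
      expansion false false = refl
      expansion false true = refl
      expansion true false = refl
      expansion true true = refl

  pairFree⇒trade : ∀ {n} {T : GR n} → PairFree T → IsTrade 2 T
  pairFree⇒trade {n} {T} (zero₀ , pairs) i i≤2 S refl with size-2 S i≤2
  ... | inj₁ refl = trans (blocksContaining-· T ∅) (trans (·-cong T ∅⊆?) (trans (·-true T) zero₀))
  ... | inj₂ (u , v , refl) = trans (blocksContaining-· T _) (trans (·-cong T (pair⊆? u v)) (pairs u false v false))

  translate : ∀ {n} → Subset n → GR n → GR n
  translate W T X = T (W ⊕ X)

  pairFree-translate : ∀ {n} W {T : GR n} → PairFree T → PairFree (translate W T)
  pairFree-translate W {T} (zero₀ , pairs) = trans (∑-⊕ W T) zero₀ , λ u b v c →
    trans (∑-cong λ X → cong (λ p → T (W ⊕ X) * ι p) (cong₂ _∧_ (move u b X) (move v c X)))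
      (trans (∑-⊕ W (λ X → T X * ι (col u (b xor lookup W u) X ∧ col v (c xor lookup W v) X)))
          (pairs u (b xor lookup W u) v (c xor lookup W v)))
    where
    move : ∀ u b X → col u b X ≡ col u (b xor lookup W u) (W ⊕ X)
    move u b X rewrite lookup-zipWith _xor_ u W X = trans (cong (b xor_)
        (sym (trans (sym (xor-assoc w w _)) (cong (_xor lookup X u) (xor-same w)))))
      (sym (xor-assoc b w (w xor lookup X u)))
      where w = lookup W u

  volume-translate : ∀ {n} W (T : GR n) → volume (translate W T) ≡ volume T
  volume-translate W T = ∑-⊕ W (λ X → T X ⊔ + 0)

  -- The block lists of a group-ring element

  positive : ℤ → ℕ
  positive (+ k) = k
  positive -[1+ _ ] = 0

  positive-⊔ : ∀ z → z ⊔ + 0 ≡ + positive z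
  positive-⊔ (+ k) = cong +_ (ℕₚ.⊔-identityʳ k)
  positive-⊔ -[1+ k ] = refl

  positive-difference : ∀ z → + positive z - + positive (- z) ≡ z
  positive-difference (+ zero) = refl
  positive-difference (+ suc k) = +-identityʳ _
  positive-difference -[1+ k ] = refl

  blocks : ∀ {n} → (Subset n → ℕ) → List (Subset n)
  blocks {n} m = concatMap (λ X → replicate (m X) X) (allSubsets n)

  sumℤ-replicate : ∀ {A : Set} (φ : A → ℤ) k a → sumℤ (map φ (replicate k a)) ≡ + k * φ a
  sumℤ-replicate φ zero a = sym (*-zeroˡ (φ a))
  sumℤ-replicate φ (suc k) a = trans (cong (λ s → φ a + s) (sumℤ-replicate φ k a))
    (trans (cong (_+ + k * φ a) (sym (*-identityˡ (φ a)))) (sym (ℤₚ.*-distribʳ-+ (φ a) (+ 1) (+ k))))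

  sumℤ-blocks : ∀ {n} (φ : GR n) (m : Subset n → ℕ) → sumℤ (map φ (blocks m)) ≡ ∑ (λ X → + m X * φ X)
  sumℤ-blocks {n} φ m = go (allSubsets n)
    where
    go : ∀ Xs → sumℤ (map φ (concatMap (λ X → replicate (m X) X) Xs)) ≡ sumℤ (map (λ X → + m X * φ X) Xs)
    go [] = refl
    go (X ∷ Xs) = trans (cong sumℤ (map-++ φ (replicate (m X) X) _))
      (trans (sumℤ-++ (map φ (replicate (m X) X)) _) (cong₂ _+_ (sumℤ-replicate φ (m X) X) (go Xs)))

  ∈-replicate : ∀ {A : Set} {a b : A} k → a ∈ replicate k b → a ≡ b × k ≢ 0
  ∈-replicate (suc k) (here e) = e , λ ()
  ∈-replicate (suc k) (there p) = proj₁ (∈-replicate k p) , λ ()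

  ∈-blocks : ∀ {n} (m : Subset n → ℕ) {X} → X ∈ blocks m → m X ≢ 0
  ∈-blocks {n} m p with Y , _ , q ← find (∈-concatMap⁻ (λ X → replicate (m X) X) {allSubsets n} p) with refl ,
      h ← ∈-replicate (m Y) q = h

  plusBlocks minusBlocks : ∀ {n} → GR n → List (Subset n)
  plusBlocks T = blocks (λ X → positive (T X))
  minusBlocks T = blocks (λ X → positive (- T X))

  -- With `φ` constant 1, an indicator of two columns, or a point mass, this gives the equality of
  -- the leg sizes, the balance of the legs, and the recovery of `T` from its blocks.
  blocks-difference : ∀ {n} (T φ : GR n) → sumℤ (map φ (plusBlocks T)) - sumℤ (map φ (minusBlocks T))
      ≡ ∑ (λ X → T X * φ X)
  blocks-difference T φ = trans (cong₂ _-_ (sumℤ-blocks φ (λ X → positive (T X)))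
      (sumℤ-blocks φ (λ X → positive (- T X))))
    (trans (sym (∑-- (λ X → + positive (T X) * φ X) (λ X → + positive (- T X) * φ X)))
      (∑-cong λ X → trans (sym (distrib (+ positive (T X)) (+ positive (- T X)) (φ X)))
          (cong (_* φ X) (positive-difference (T X)))))
    where
    distrib : ∀ a b c → (a - b) * c ≡ a * c - b * c
    distrib = solve-∀

  blocks-apart : ∀ {n} (T : GR n) {p m} → p ∈ plusBlocks T → m ∈ minusBlocks T → p ≢ m
  blocks-apart T {p} p∈ m∈ refl = exclusive (T p) (∈-blocks (λ X → positive (T X)) p∈)
      (∈-blocks (λ X → positive (- T X)) m∈)
    where
    exclusive : ∀ z → positive z ≢ 0 → positive (- z) ≢ 0 → ⊥
    exclusive (+ zero) h _ = h refl
    exclusive (+ suc k) _ h = h refl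
    exclusive -[1+ k ] h _ = h refl

  sumℤ-length : ∀ {A : Set} (rs : List A) → sumℤ (map (λ _ → + 1) rs) ≡ + length rs
  sumℤ-length [] = refl
  sumℤ-length (r ∷ rs) = cong (λ s → + 1 + s) (sumℤ-length rs)

  sumℤ-cnt : ∀ {A : Set} (κ : A → Bool) rs → sumℤ (map (ι ∘ κ) rs) ≡ + cnt κ rs
  sumℤ-cnt κ [] = refl
  sumℤ-cnt κ (r ∷ rs) with κ r
  ... | false = cong (λ s → + 0 + s) (sumℤ-cnt κ rs)
  ... | true = cong (λ s → + 1 + s) (sumℤ-cnt κ rs)

  length-plus : ∀ {n} (T : GR n) → + length (plusBlocks T) ≡ volume T
  length-plus T = trans (sym (sumℤ-length (plusBlocks T))) (trans (sumℤ-blocks (λ _ → + 1) (λ X → positive (T X)))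
    (∑-cong λ X → trans (ℤₚ.*-identityʳ _) (sym (positive-⊔ (T X)))))

  length-minus : ∀ {n} (T : GR n) → ∑ T ≡ + 0 → length (minusBlocks T) ≡ length (plusBlocks T)
  length-minus T e = sym (ℤₚ.+-injective (ℤₚ.i-j≡0⇒i≡j _ _ (trans
      (cong₂ _-_ (sym (sumℤ-length (plusBlocks T))) (sym (sumℤ-length (minusBlocks T))))
    (trans (blocks-difference T (λ _ → + 1)) (trans (·-true T) e)))))

  blocks-balanced : ∀ {n} {T : GR n} → PairFree T → Balanced (plusBlocks T) (minusBlocks T)
  blocks-balanced {T = T} (_ , pairs) u b v c = ℤₚ.+-injective (ℤₚ.i-j≡0⇒i≡j _ _
    (trans (cong₂ _-_ (sym (sumℤ-cnt κ (plusBlocks T))) (sym (sumℤ-cnt κ (minusBlocks T))))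
      (trans (blocks-difference T (ι ∘ κ)) (pairs u b v c))))
    where κ = λ r → col u b r ∧ col v c r

  sumℤ-⟦⟧ : ∀ {n} (X : Subset n) rs → sumℤ (map ⟦ X ⟧ rs) ≡ + length (filter (_≟ˢ X) rs)
  sumℤ-⟦⟧ X [] = refl
  sumℤ-⟦⟧ X (r ∷ rs) with r ≟ˢ X
  ... | yes refl = cong₂ _+_ (⟦⟧-yes r) (sumℤ-⟦⟧ X rs)
  ... | no ¬e = trans (cong₂ _+_ (⟦⟧-no (¬e ∘ sym)) (sumℤ-⟦⟧ X rs)) (+-identityˡ _)

  fromPair-blocks : ∀ {n} (T : GR n) → T ≐ fromPair (plusBlocks T) (minusBlocks T)
  fromPair-blocks T X = sym (trans (cong₂ _-_ (sym (sumℤ-⟦⟧ X (plusBlocks T))) (sym (sumℤ-⟦⟧ X (minusBlocks T))))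
    (trans (blocks-difference T ⟦ X ⟧) (trans (∑-cong λ Y → ℤₚ.*-comm (T Y) (⟦ X ⟧ Y)) (∑-δ X T))))

  -- Products in the group ring

  ⟦⟧-sym : ∀ {n} (X Y : Subset n) → ⟦ X ⟧ Y ≡ ⟦ Y ⟧ X
  ⟦⟧-sym X Y = ⟦⟧-iff {X = X} {Y} {Y} {X} sym sym

  ⟦⟧-⊕ : ∀ {n} (A B X : Subset n) → ⟦ A ⟧ (B ⊕ X) ≡ ⟦ A ⊕ B ⟧ X
  ⟦⟧-⊕ A B X = ⟦⟧-iff {X = A} {B ⊕ X} {A ⊕ B} {X}
    (λ { refl → trans (⊕-comm (B ⊕ X) B) (⊕-cancelˡ B X) })
    (λ { refl → trans (sym (⊕-cancelˡ B A)) (cong (B ⊕_) (⊕-comm B A)) })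

  -- As a function of the summation variable, the second factor is the difference of the point
  -- masses at `X` and `C ⊕ X`, so `∑-δ` evaluates the convolution.
  *ᵍ-1- : ∀ {n} (f : GR n) C → f *ᵍ (1- C) ≐ λ X → f X - f (C ⊕ X)
  *ᵍ-1- f C X = trans (∑-cong step) (trans (∑-- (λ Y → ⟦ X ⟧ Y * f Y) (λ Y → ⟦ C ⊕ X ⟧ Y * f Y))
      (cong₂ _-_ (∑-δ X f) (∑-δ (C ⊕ X) f)))
    where
    arrangement : ∀ a b c → a * (b - c) ≡ b * a - c * a
    arrangement = solve-∀
    δ : ∀ A Y → ⟦ A ⟧ (Y ⊕ X) ≡ ⟦ A ⊕ X ⟧ Y
    δ A Y = trans (cong ⟦ A ⟧ (⊕-comm Y X)) (⟦⟧-⊕ A X Y)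
    step : ∀ Y → f Y * (1- C) (Y ⊕ X) ≡ ⟦ X ⟧ Y * f Y - ⟦ C ⊕ X ⟧ Y * f Y
    step Y = trans (cong (f Y *_) (cong₂ _-_ (trans (δ ∅ Y) (cong (λ A → ⟦ A ⟧ Y) (⊕-identityˡ X))) (δ C Y)))
      (arrangement (f Y) (⟦ X ⟧ Y) (⟦ C ⊕ X ⟧ Y))

  ⟪_⟫ : ∀ {n} → List (Subset n) → GR n
  ⟪ rs ⟫ X = sumℤ (map (λ r → ⟦ r ⟧ X) rs)

  cube : ∀ {n} (A B C : Subset n) → GR n
  cube A B C X = ((⟦ ∅ ⟧ X - ⟦ A ⟧ X) - (⟦ B ⟧ X - ⟦ A ⊕ B ⟧ X)) -
      ((⟦ C ⟧ X - ⟦ A ⊕ C ⟧ X) - (⟦ B ⊕ C ⟧ X - ⟦ A ⊕ B ⊕ C ⟧ X))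

  expand : ∀ {n} (A B C : Subset n) → (1- A) *ᵍ (1- B) *ᵍ (1- C) ≐ cube A B C
  expand A B C X = trans (*ᵍ-1- ((1- A) *ᵍ (1- B)) C X) (cong₂ _-_ (square X)
    (trans (square (C ⊕ X)) (cong₂ _-_ (cong₂ _-_ (δ∅ C) (⟦⟧-⊕ A C X)) (cong₂ _-_ (⟦⟧-⊕ B C X) (⟦⟧-⊕ (A ⊕ B) C X)))))
    where
    δ∅ : ∀ {X} B → ⟦ ∅ ⟧ (B ⊕ X) ≡ ⟦ B ⟧ X
    δ∅ {X} B = trans (⟦⟧-⊕ ∅ B X) (cong (λ A → ⟦ A ⟧ X) (⊕-identityˡ B))
    square : ∀ X → ((1- A) *ᵍ (1- B)) X ≡ (⟦ ∅ ⟧ X - ⟦ A ⟧ X) - (⟦ B ⟧ X - ⟦ A ⊕ B ⟧ X)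
    square X = trans (*ᵍ-1- (1- A) B X) (cong (λ d → (⟦ ∅ ⟧ X - ⟦ A ⟧ X) - d) (cong₂ _-_ (δ∅ B) (⟦⟧-⊕ A B X)))

  fromPair-⟪⟫ : ∀ {n} (P M : List (Subset n)) → fromPair P M ≐ ⟪ P ⟫ -ᵍ ⟪ M ⟫
  fromPair-⟪⟫ P M X = cong₂ _-_ (count-⟪⟫ P) (count-⟪⟫ M)
    where
    count-⟪⟫ : ∀ rs → + length (filter (_≟ˢ X) rs) ≡ ⟪ rs ⟫ X
    count-⟪⟫ rs = trans (sym (sumℤ-⟦⟧ X rs)) (cong sumℤ (map-cong (⟦⟧-sym X) rs))

  filter-translate : ∀ {n} (W X : Subset n) rs → length (filter (_≟ˢ (W ⊕ X)) (map (W ⊕_) rs))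
      ≡ length (filter (_≟ˢ X) rs)
  filter-translate W X [] = refl
  filter-translate W X (r ∷ rs) with (W ⊕ r) ≟ˢ (W ⊕ X) | r ≟ˢ X
  ... | yes _ | yes _ = cong suc (filter-translate W X rs)
  ... | no _ | no _ = filter-translate W X rs
  ... | yes e | no ¬e = contradiction (trans (sym (⊕-cancelˡ W r)) (trans (cong (W ⊕_) e) (⊕-cancelˡ W X))) ¬e
  ... | no ¬e | yes e = contradiction (cong (W ⊕_) e) ¬e

  -- From membership vectors to the four forms

  Subset-ext : ∀ {n} {X Y : Subset n} → (∀ v → lookup X v ≡ lookup Y v) → X ≡ Y
  Subset-ext {X = X} {Y} h = trans (sym (tabulate∘lookup X)) (trans (tabulate-cong h) (tabulate∘lookup Y))

  -- For empty V there is no column that could show the number of rows, hence the hypothesis on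
  -- lengths.
  rows-ext : ∀ {n} (xs ys : List (Subset n)) → length xs ≡ length ys →
    (∀ v → map (λ r → lookup r v) xs ≡ map (λ r → lookup r v) ys) → xs ≡ ys
  rows-ext [] [] _ _ = refl
  rows-ext (x ∷ xs) (y ∷ ys) e h = cong₂ _∷_ (Subset-ext (proj₁ ∘ ∷-injective ∘ h))
    (rows-ext xs ys (ℕₚ.suc-injective e) (proj₂ ∘ ∷-injective ∘ h))

  record Model {n} (F : Shape) (σ : Fin 7 → Subset n) (τ : GR n) : Set where
    field
      disjointness : All (λ (i , j) → Disjoint (σ i) (σ j)) (disjoint F)
      inhabited : All (λ i → Nonempty (σ i)) (nonempty F)
      distinctness : All (λ (i , j) → σ i ≢ σ j) (distinct F)
      related : eval _⊕_ σ (proj₁ (relation F)) ≡ eval _⊕_ σ (proj₂ (relation F))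
      presented : τ ≐ fromPair (map (eval _⊕_ σ) (plus F)) (map (eval _⊕_ σ) (minus F))

  open Model

  presented-⟪⟫ : ∀ {n F} {σ : Fin 7 → Subset n} {τ} → Model F σ τ →
    τ ≐ ⟪ map (eval _⊕_ σ) (plus F) ⟫ -ᵍ ⟪ map (eval _⊕_ σ) (minus F) ⟫
  presented-⟪⟫ {F = F} {σ} m X = trans (presented m X) (fromPair-⟪⟫ (map (eval _⊕_ σ) (plus F))
      (map (eval _⊕_ σ) (minus F)) X)

  ⊕-cancel-common : ∀ {n} (X A B : Subset n) → (X ⊕ A) ⊕ (X ⊕ B) ≡ A ⊕ B
  ⊕-cancel-common X A B = trans (⊕-assoc X A (X ⊕ B)) (trans (cong (X ⊕_)
    (trans (⊕-comm A (X ⊕ B)) (trans (⊕-assoc X B A) (cong (X ⊕_) (⊕-comm B A))))) (⊕-cancelˡ X (A ⊕ B)))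

  ⊕-common³ : ∀ {n} (X A B C : Subset n) → (X ⊕ A) ⊕ (X ⊕ B) ⊕ (X ⊕ C) ≡ X ⊕ (A ⊕ B ⊕ C)
  ⊕-common³ X A B C = trans (cong (_⊕ (X ⊕ C)) (⊕-cancel-common X A B))
    (trans (sym (⊕-assoc (A ⊕ B) X C)) (trans (cong (_⊕ C) (⊕-comm (A ⊕ B) X)) (⊕-assoc X (A ⊕ B) C)))

  toForm₁ : ∀ {n} {σ : Fin 7 → Subset n} {τ} → Model form₁ σ τ → Form1 τ
  toForm₁ {n} {σ} {τ} m
    with (d₁ ∷ d₂ ∷ d₃ ∷ d₄ ∷ d₅ ∷ d₆ ∷ d₇ ∷ d₈ ∷ d₉ ∷ d₁₀ ∷ d₁₁ ∷ d₁₂ ∷ []) ← disjointness m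
       | (e₁ ∷ e₂ ∷ e₃ ∷ e₄ ∷ e₅ ∷ e₆ ∷ []) ← inhabited m
       | (f₁ ∷ f₂ ∷ f₃ ∷ f₄ ∷ f₅ ∷ f₆ ∷ f₇ ∷ f₈ ∷ f₉ ∷ f₁₀ ∷ f₁₁ ∷ f₁₂ ∷ f₁₃ ∷ f₁₄ ∷ f₁₅ ∷ []) ← distinctness m
    = σ 𝕩 , σ 𝕪₁ , σ 𝕪₂ , σ 𝕪₃ , σ 𝕫₁ , σ 𝕫₂ , σ 𝕫₃ ,
      d₁ , d₂ , d₃ , d₄ , d₅ , d₆ , d₇ , d₈ , d₉ , d₁₀ , d₁₁ , d₁₂ ,
      f₁ , f₂ , f₃ , f₄ , f₅ , f₆ , f₇ , f₈ , f₉ , f₁₀ , f₁₁ , f₁₂ , f₁₃ , f₁₄ , f₁₅ ,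
      e₁ , e₂ , e₃ , e₄ , e₅ , e₆ , related m , equation
    where
    X = σ 𝕩
    -- The variable `abc` occurs in both cubes: it stands for the triple product, which `related`
    -- identifies. It and `o` cancel.
    regroup : ∀ o a b c ab ac bc abc a′ b′ c′ ab′ ac′ bc′ →
      (ab + (ac + (bc + (a′ + (b′ + (c′ + + 0)))))) - (ab′ + (ac′ + (bc′ + (a + (b + (c + + 0)))))) ≡
      (((o - a) - (b - ab)) - ((c - ac) - (bc - abc))) - (((o - a′) - (b′ - ab′)) - ((c′ - ac′) - (bc′ - abc)))
    regroup = solve-∀
    simplify : ∀ A B C W → cube (X ⊕ A) (X ⊕ B) (X ⊕ C) W ≡
      ((⟦ ∅ ⟧ W - ⟦ X ⊕ A ⟧ W) - (⟦ X ⊕ B ⟧ W - ⟦ A ⊕ B ⟧ W)) -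
      ((⟦ X ⊕ C ⟧ W - ⟦ A ⊕ C ⟧ W) - (⟦ B ⊕ C ⟧ W - ⟦ X ⊕ (A ⊕ B ⊕ C) ⟧ W))
    -- The first rewriting also reaches into the triple product on the left. The right side is
    -- therefore expanded by `⊕-common³` and rewritten in the same way until both agree.
    simplify A B C W rewrite ⊕-cancel-common X A B | ⊕-cancel-common X A C | ⊕-cancel-common X B C
      | sym (⊕-common³ X A B C) | ⊕-cancel-common X A B = refl
    equation : τ ≐ _
    equation W = trans (presented-⟪⟫ m W) (trans
      (regroup (⟦ ∅ ⟧ W) (⟦ X ⊕ σ 𝕪₁ ⟧ W) (⟦ X ⊕ σ 𝕪₂ ⟧ W) (⟦ X ⊕ σ 𝕪₃ ⟧ W)
        (⟦ σ 𝕪₁ ⊕ σ 𝕪₂ ⟧ W) (⟦ σ 𝕪₁ ⊕ σ 𝕪₃ ⟧ W) (⟦ σ 𝕪₂ ⊕ σ 𝕪₃ ⟧ W) (⟦ X ⊕ (σ 𝕪₁ ⊕ σ 𝕪₂ ⊕ σ 𝕪₃) ⟧ W)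
        (⟦ X ⊕ σ 𝕫₁ ⟧ W) (⟦ X ⊕ σ 𝕫₂ ⟧ W) (⟦ X ⊕ σ 𝕫₃ ⟧ W)
        (⟦ σ 𝕫₁ ⊕ σ 𝕫₂ ⟧ W) (⟦ σ 𝕫₁ ⊕ σ 𝕫₃ ⟧ W) (⟦ σ 𝕫₂ ⊕ σ 𝕫₃ ⟧ W))
      (sym (cong₂ _-_
        (trans (expand (X ⊕ σ 𝕪₁) (X ⊕ σ 𝕪₂) (X ⊕ σ 𝕪₃) W) (simplify (σ 𝕪₁) (σ 𝕪₂) (σ 𝕪₃) W))
        (trans (expand (X ⊕ σ 𝕫₁) (X ⊕ σ 𝕫₂) (X ⊕ σ 𝕫₃) W) (trans (simplify (σ 𝕫₁) (σ 𝕫₂) (σ 𝕫₃) W)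
          (cong (λ Q → ((⟦ ∅ ⟧ W - ⟦ X ⊕ σ 𝕫₁ ⟧ W) - (⟦ X ⊕ σ 𝕫₂ ⟧ W - ⟦ σ 𝕫₁ ⊕ σ 𝕫₂ ⟧ W)) -
            ((⟦ X ⊕ σ 𝕫₃ ⟧ W - ⟦ σ 𝕫₁ ⊕ σ 𝕫₃ ⟧ W) - (⟦ σ 𝕫₂ ⊕ σ 𝕫₃ ⟧ W - ⟦ X ⊕ Q ⟧ W))) (sym (related m))))))))

  toForm₂ : ∀ {n} {σ : Fin 7 → Subset n} {τ} → Model form₂ σ τ → Form2 τ
  toForm₂ {n} {σ} {τ} m
    with (d₁ ∷ d₂ ∷ d₃ ∷ d₄ ∷ d₅ ∷ d₆ ∷ []) ← disjointness m
       | (e₁ ∷ e₂ ∷ e₃ ∷ e₄ ∷ e₅ ∷ e₆ ∷ []) ← inhabited m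
       | (f₁ ∷ f₂ ∷ f₃ ∷ f₄ ∷ f₅ ∷ f₆ ∷ f₇ ∷ f₈ ∷ f₉ ∷ f₁₀ ∷ f₁₁ ∷ f₁₂ ∷ f₁₃ ∷ f₁₄ ∷ f₁₅ ∷ []) ← distinctness m
    = σ 𝕪₁ , σ 𝕪₂ , σ 𝕪₃ , σ 𝕫₁ , σ 𝕫₂ , σ 𝕫₃ ,
      d₁ , d₂ , d₃ , d₄ , d₅ , d₆ , e₁ , e₂ , e₃ , e₄ , e₅ , e₆ ,
      f₁ , f₂ , f₃ , f₄ , f₅ , f₆ , f₇ , f₈ , f₉ , f₁₀ , f₁₁ , f₁₂ , f₁₃ , f₁₄ , f₁₅ ,
      related m , equation
    where
    regroup : ∀ o a b c ab ac bc abc a′ b′ c′ ac′ bc′ abc′ →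
      (ac + (bc + (a′ + (b′ + (c′ + (abc′ + + 0)))))) - (ac′ + (bc′ + (a + (b + (c + (abc + + 0)))))) ≡
      (((o - a) - (b - ab)) - ((c - ac) - (bc - abc))) - (((o - a′) - (b′ - ab)) - ((c′ - ac′) - (bc′ - abc′)))
    regroup = solve-∀
    equation : τ ≐ _
    equation W = trans (presented-⟪⟫ m W) (trans
      (regroup (⟦ ∅ ⟧ W) (⟦ σ 𝕪₁ ⟧ W) (⟦ σ 𝕪₂ ⟧ W) (⟦ σ 𝕪₃ ⟧ W)
        (⟦ σ 𝕪₁ ⊕ σ 𝕪₂ ⟧ W) (⟦ σ 𝕪₁ ⊕ σ 𝕪₃ ⟧ W) (⟦ σ 𝕪₂ ⊕ σ 𝕪₃ ⟧ W) (⟦ σ 𝕪₁ ⊕ σ 𝕪₂ ⊕ σ 𝕪₃ ⟧ W)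
        (⟦ σ 𝕫₁ ⟧ W) (⟦ σ 𝕫₂ ⟧ W) (⟦ σ 𝕫₃ ⟧ W)
        (⟦ σ 𝕫₁ ⊕ σ 𝕫₃ ⟧ W) (⟦ σ 𝕫₂ ⊕ σ 𝕫₃ ⟧ W) (⟦ σ 𝕫₁ ⊕ σ 𝕫₂ ⊕ σ 𝕫₃ ⟧ W))
      (sym (cong₂ _-_ (expand (σ 𝕪₁) (σ 𝕪₂) (σ 𝕪₃) W)
        (trans (expand (σ 𝕫₁) (σ 𝕫₂) (σ 𝕫₃) W)
          (cong (λ Q → ((⟦ ∅ ⟧ W - ⟦ σ 𝕫₁ ⟧ W) - (⟦ σ 𝕫₂ ⟧ W - ⟦ Q ⟧ W)) -
            ((⟦ σ 𝕫₃ ⟧ W - ⟦ σ 𝕫₁ ⊕ σ 𝕫₃ ⟧ W) - (⟦ σ 𝕫₂ ⊕ σ 𝕫₃ ⟧ W - ⟦ σ 𝕫₁ ⊕ σ 𝕫₂ ⊕ σ 𝕫₃ ⟧ W)))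
                (sym (related m)))))))

  toForm₃ : ∀ {n} {σ : Fin 7 → Subset n} {τ} → Model form₃ σ τ → Form3 τ
  toForm₃ {n} {σ} {τ} m
    with (d₁ ∷ d₂ ∷ d₃ ∷ d₄ ∷ d₅ ∷ d₆ ∷ d₇ ∷ d₈ ∷ d₉ ∷ d₁₀ ∷ []) ← disjointness m
       | (e₁ ∷ e₂ ∷ e₃ ∷ e₄ ∷ e₅ ∷ []) ← inhabited m
    = σ 𝕪₁ , σ 𝕪₂ , σ 𝕪₃ , σ 𝕫₁ , σ 𝕫₂ ,
      d₁ , d₂ , d₃ , d₄ , d₅ , d₆ , d₇ , d₈ , d₉ , d₁₀ , e₁ , e₂ , e₃ , e₄ , e₅ , equation
    where
    Y = σ 𝕪₁ ⊕ σ 𝕪₂ ⊕ σ 𝕪₃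
    regroup : ∀ o a b c ab ac bc abc a′ b′ ab′ ac′ bc′ abc′ →
      (ab + (ac + (bc + (a′ + (b′ + (abc′ + + 0)))))) - (ab′ + (ac′ + (bc′ + (a + (b + (c + + 0)))))) ≡
      (((o - a) - (b - ab)) - ((c - ac) - (bc - abc))) - (((o - a′) - (b′ - ab′)) - ((abc - ac′) - (bc′ - abc′)))
    regroup = solve-∀
    -- `eval` multiplies one parameter at a time from the left, whereas the cube treats `Y` as a
    -- single factor.
    reassociate : ∀ Z W → ⟦ Z ⊕ Y ⟧ W ≡ ⟦ Z ⊕ σ 𝕪₁ ⊕ σ 𝕪₂ ⊕ σ 𝕪₃ ⟧ W
    reassociate Z W = cong (λ Q → ⟦ Q ⟧ W) (sym (trans (⊕-assoc (Z ⊕ σ 𝕪₁) (σ 𝕪₂) (σ 𝕪₃))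
      (trans (⊕-assoc Z (σ 𝕪₁) (σ 𝕪₂ ⊕ σ 𝕪₃)) (cong (Z ⊕_) (sym (⊕-assoc (σ 𝕪₁) (σ 𝕪₂) (σ 𝕪₃)))))))
    equation : τ ≐ _
    equation W = trans (presented-⟪⟫ m W) (trans
      (regroup (⟦ ∅ ⟧ W) (⟦ σ 𝕪₁ ⟧ W) (⟦ σ 𝕪₂ ⟧ W) (⟦ σ 𝕪₃ ⟧ W)
        (⟦ σ 𝕪₁ ⊕ σ 𝕪₂ ⟧ W) (⟦ σ 𝕪₁ ⊕ σ 𝕪₃ ⟧ W) (⟦ σ 𝕪₂ ⊕ σ 𝕪₃ ⟧ W) (⟦ Y ⟧ W)
        (⟦ σ 𝕫₁ ⟧ W) (⟦ σ 𝕫₂ ⟧ W) (⟦ σ 𝕫₁ ⊕ σ 𝕫₂ ⟧ W)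
        (⟦ σ 𝕫₁ ⊕ σ 𝕪₁ ⊕ σ 𝕪₂ ⊕ σ 𝕪₃ ⟧ W) (⟦ σ 𝕫₂ ⊕ σ 𝕪₁ ⊕ σ 𝕪₂ ⊕ σ 𝕪₃ ⟧ W) (⟦ σ 𝕫₁ ⊕ σ 𝕫₂ ⊕ σ 𝕪₁ ⊕ σ 𝕪₂ ⊕ σ 𝕪₃ ⟧ W))
      (sym (cong₂ _-_ (expand (σ 𝕪₁) (σ 𝕪₂) (σ 𝕪₃) W)
        (trans (expand (σ 𝕫₁) (σ 𝕫₂) Y W)
          (cong₂ (λ p q → ((⟦ ∅ ⟧ W - ⟦ σ 𝕫₁ ⟧ W) - (⟦ σ 𝕫₂ ⟧ W - ⟦ σ 𝕫₁ ⊕ σ 𝕫₂ ⟧ W)) - ((⟦ Y ⟧ W - p) - q))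
            (reassociate (σ 𝕫₁) W) (cong₂ _-_ (reassociate (σ 𝕫₂) W) (reassociate (σ 𝕫₁ ⊕ σ 𝕫₂) W)))))))

  toForm₄ : ∀ {n} {σ : Fin 7 → Subset n} {τ} → Model form₄ σ τ → Form4 τ
  toForm₄ {n} {σ} {τ} m
    with (d₁ ∷ d₂ ∷ d₃ ∷ d₄ ∷ d₅ ∷ d₆ ∷ d₇ ∷ d₈ ∷ d₉ ∷ d₁₀ ∷ d₁₁ ∷ d₁₂ ∷ []) ← disjointness m
       | (e₁ ∷ []) ← inhabited m
       | (f₁ ∷ f₂ ∷ f₃ ∷ f₄ ∷ f₅ ∷ f₆ ∷ f₇ ∷ f₈ ∷ f₉ ∷ []) ← distinctness m
    = σ 𝕩 , σ 𝕪₁ , σ 𝕪₂ , σ 𝕪₃ , σ 𝕫₁ , σ 𝕫₂ , σ 𝕫₃ ,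
      d₁ , d₂ , d₃ , d₄ , d₅ , d₆ , d₇ , d₈ , d₉ , d₁₀ , d₁₁ , d₁₂ , related m ,
      f₁ , f₂ , f₃ , f₄ , f₅ , f₆ , f₇ , f₈ , f₉ , e₁ , presented m

  toForm : ∀ {n} (i : Fin 4) {σ : Fin 7 → Subset n} {τ} → Model (lookup shapes i) σ τ →
      Form1 τ ⊎ Form2 τ ⊎ Form3 τ ⊎ Form4 τ
  toForm zero m = inj₁ (toForm₁ m)
  toForm (suc zero) m = inj₂ (inj₁ (toForm₂ m))
  toForm (suc (suc zero)) m = inj₂ (inj₂ (inj₁ (toForm₃ m)))
  toForm (suc (suc (suc zero))) m = inj₂ (inj₂ (inj₂ (toForm₄ m)))

  eval-lookup : ∀ {n} (σ : Fin 7 → Subset n) v m → lookup (eval _⊕_ σ m) v ≡ eval _xor_ (λ i → lookup (σ i) v) m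
  eval-lookup σ v (i , js) = go js (σ i)
    where
    go : ∀ js A → lookup (foldl (λ a j → a ⊕ σ j) A js) v ≡ foldl (λ a j → a xor lookup (σ j) v) (lookup A v) js
    go [] A = refl
    go (j ∷ js) A = trans (go js (A ⊕ σ j)) (cong (λ b → foldl (λ a j → a xor lookup (σ j) v) b js)
        (lookup-zipWith _xor_ v A (σ j)))

  eval-cong : ∀ {A : Set} (_∙_ : A → A → A) {s t : Fin 7 → A} → (∀ i → s i ≡ t i) → ∀ m → eval _∙_ s m ≡ eval _∙_ t m
  eval-cong {A} _∙_ {s} {t} h (i , js) = go js (h i)
    where
    go : ∀ js {a b} → a ≡ b → foldl (λ a j → a ∙ s j) a js ≡ foldl (λ a j → a ∙ t j) b js
    go [] e = e
    go (j ∷ js) e = go js (cong₂ _∙_ e (h j))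

  -- The existence of a test matters because its realization is an element of V. The column of that
  -- element has one entry for each block, so the number of blocks can be read off there.
  six : ∀ i → length (plus (lookup shapes i)) ≡ 6 × length (minus (lookup shapes i))
      ≡ 6 × ∃ (_∈ tests (lookup shapes i))
  six zero = refl , refl , _ , here refl
  six (suc zero) = refl , refl , _ , here refl
  six (suc (suc zero)) = refl , refl , _ , here refl
  six (suc (suc (suc zero))) = refl , refl , _ , here refl

  does-sound : ∀ {Q : Set} (q? : Dec Q) → T (does q?) → Q
  does-sound (yes q) _ = q

  module _ {n} {P₀ M₀ : List (Subset n)} (fit : Fit P₀ M₀) where

    open Fit fit

    σ : Fin 7 → Subset n
    σ i = tabulate (λ v → lookup (params v) i)

    W : Subset n
    W = tabulate flips

    point : Fin n
    point = proj₁ (realized (proj₂ (proj₂ (proj₂ (six index)))))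

    lookup-σ : ∀ v i → lookup (σ i) v ≡ lookup (params v) i
    lookup-σ v i = lookup∘tabulate (λ v → lookup (params v) i) v

    eval-σ : ∀ v m → lookup (eval _⊕_ σ m) v ≡ eval _xor_ (lookup (params v)) m
    eval-σ v m = trans (eval-lookup σ v m) (eval-cong _xor_ (lookup-σ v) m)

    rows≡ : ∀ {rs ms} → (∀ v → map (λ r → lookup r v) rs ≡ values (flips v) ms (params v)) → rs
        ≡ map (W ⊕_) (map (eval _⊕_ σ) ms)
    rows≡ {rs} {ms} h = rows-ext rs _
      (trans (sym (length-map _ rs)) (trans (cong length (h point))
          (trans (length-map _ ms) (sym (trans (length-map (W ⊕_) (map (eval _⊕_ σ) ms)) (length-map _ ms))))))
      (λ v → trans (h v) (sym (trans (sym (map-∘ (map (eval _⊕_ σ) ms))) (trans (sym (map-∘ ms)) (map-cong (λ m →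
        trans (lookup-zipWith _xor_ v W (eval _⊕_ σ m)) (cong₂ _xor_ (lookup∘tabulate flips v) (eval-σ v m))) ms)))))

    length-P₀ : length P₀ ≡ 6
    length-P₀ = trans (sym (↭-length P↭P₀)) (trans (sym (length-map _ P)) (trans (cong length (plus≡ point))
      (trans (length-map _ (plus F)) (proj₁ (six index)))))

    filter-rows : ∀ {rs rs₀ ms} → rs ↭ rs₀ → rs ≡ map (W ⊕_) ms → ∀ X → length (filter (_≟ˢ (W ⊕ X)) rs₀)
        ≡ length (filter (_≟ˢ X) ms)
    filter-rows {ms = ms} p refl X = trans (sym (↭-length (filter-↭ (_≟ˢ (W ⊕ X)) p))) (filter-translate W X ms)

    admissibility : ∀ v → T (admissible F (params v))
    admissibility v = proj₂ (∈-filter⁻ (T? ∘ admissible F) {xs = allSubsets 7} (params∈table v))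

    disjoint-bits : ∀ v {i j} → (i , j) ∈ disjoint F → lookup (params v) i ∧ lookup (params v) j ≡ false
    disjoint-bits v {i} {j} p = not-true (All.lookup (all⁺ _ (disjoint F)
        (proj₁ (T-∧⁻ (proj₂ (T-∧⁻ {all (λ i → not (lookup (params v) i)) (unused F)} (admissibility v)))))) p)
      where
      not-true : ∀ {b} → T (not b) → b ≡ false
      not-true {false} _ = refl

    related-bits : ∀ v → eval _xor_ (lookup (params v)) (proj₁ (relation F))
        ≡ eval _xor_ (lookup (params v)) (proj₂ (relation F))
    related-bits v = does-sound (_ ≟ᵇ _) (proj₂ (T-∧⁻ {all (λ (i , j) →
        not (lookup (params v) i ∧ lookup (params v) j)) (disjoint F)}
      (proj₂ (T-∧⁻ {all (λ i → not (lookup (params v) i)) (unused F)} (admissibility v)))))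

    model : ∀ {T₀ : GR n} → T₀ ≐ fromPair P₀ M₀ → Model F σ (translate W T₀)
    model {T₀} e = record
      { disjointness = All.tabulate λ {(i , j)} p → Subset-ext λ v → trans (lookup-zipWith _∧_ v (σ i) (σ j))
          (trans (cong₂ _∧_ (lookup-σ v i) (lookup-σ v j)) (trans (disjoint-bits v p)
              (sym (lookup-replicate v false))))
      ; inhabited = All.tabulate λ {i} p → let v , t = realized (∈-++⁺ˡ (∈-map⁺ (λ i e → lookup e i) p)) in
          v , lookup⇒[]= v (σ i) (trans (lookup-σ v i) (Equivalence.to T-≡ t))
      ; distinctness = All.tabulate λ {(i , j)} p same →
          let v , t = realized (∈-++⁺ʳ (map (λ i e → lookup e i) (nonempty F))
                        (∈-map⁺ (λ (i , j) e → lookup e i xor lookup e j) p)) in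
          subst T (trans (cong₂ _xor_ (trans (sym (lookup-σ v i)) (cong (λ X → lookup X v) same))
              (sym (lookup-σ v j))) (xor-same (lookup (σ j) v))) t
      ; related = Subset-ext λ v → trans (eval-σ v (proj₁ (relation F)))
        (trans (related-bits v) (sym (eval-σ v (proj₂ (relation F)))))
      -- Every block is `W ⊕` a monomial, so `W ⊕ X` occurs among the blocks as often as `X` among
      -- the monomials.
      ; presented = λ X → trans (e (W ⊕ X)) (cong₂ (λ a b → + a - + b)
          (filter-rows P↭P₀ (rows≡ plus≡) X) (filter-rows M↭M₀ (rows≡ minus≡) X))
      }

open Classification
open Trades
open import Data.Integer.Properties using (+-injective)
open import Data.Nat using (_≤_)
open import Data.Nat.Properties using (m≤m+n)

-- Certificates of the two searches

-- Found by computer; every configuration is preceded by those that it leads to.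
nodes₅ : List (Node × Rule)
nodes₅ =
  (node 5 1 1010101 1010101 , mixed 0) ∷
  (node 5 4 204081415 6101215 , mixed 8) ∷
  (node 5 4 204091415 6111314 , mixed 7) ∷
  (node 5 4 205081415 7101314 , mixed 7) ∷
  (node 5 4 304081415 7111214 , mixed 7) ∷
  (node 5 3 102040707 3050607 , mixed 7) ∷
  (node 5 4 204081314 6101213 , mixed 7) ∷
  (node 5 4 204091215 6111213 , mixed 6) ∷
  (node 5 4 205081215 7101213 , mixed 6) ∷
  (node 5 4 304081315 7111213 , mixed 7) ∷
  (node 5 3 102040607 3050606 , mixed 6) ∷
  (node 5 2 1020303 1020303 , mixed 0) ∷
  (node 5 2 1020202 1020202 , mixed 0) ∷
  (node 5 1 10101 10101 , mixed 0) ∷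
  (node 5 0 0 0 , mixed 0) ∷
  []


nodes₆ : List (Node × Rule)
nodes₆ =
  (node 6 1 101010101 101010101 , mixed 0) ∷
  (node 6 5 40816283031 1220243031 , mixed 8) ∷
  (node 6 5 40817293031 1221253031 , mixed 8) ∷
  (node 6 5 40916293031 1320253031 , mixed 8) ∷
  (node 6 5 50816293031 1321243031 , mixed 8) ∷
  (node 6 4 20408141515 610121515 , mixed 8) ∷
  (node 6 4 20408141415 610121415 , mixed 8) ∷
  (node 6 4 20409141515 611131415 , mixed 7) ∷
  (node 6 5 40818282930 1222262829 , mixed 7) ∷
  (node 6 5 40819282931 1223272829 , mixed 7) ∷
  (node 6 5 40918282931 1322272829 , mixed 7) ∷
  (node 6 5 50818282931 1323262829 , mixed 7) ∷
  (node 6 4 20409141415 611131414 , mixed 7) ∷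
  (node 6 4 20508141515 710131415 , mixed 7) ∷
  (node 6 5 41016282930 1420262829 , mixed 7) ∷
  (node 6 5 41017282931 1421272829 , mixed 7) ∷
  (node 6 5 41116282931 1520272829 , mixed 7) ∷
  (node 6 5 51016282931 1521262829 , mixed 7) ∷
  (node 6 4 20508141415 710131414 , mixed 7) ∷
  (node 6 4 30408141515 711121415 , mixed 7) ∷
  (node 6 5 60816282930 1422242829 , mixed 7) ∷
  (node 6 5 60817282931 1423252829 , mixed 7) ∷
  (node 6 5 60916282931 1522252829 , mixed 7) ∷
  (node 6 5 70816282931 1523242829 , mixed 7) ∷
  (node 6 4 30408141415 711121414 , mixed 7) ∷
  (node 6 3 10204070707 305060707 , mixed 7) ∷
  (node 6 5 40816272930 1220252631 , fitting (# 3) 125 342) ∷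
  (node 6 5 40817262831 1221242730 , fitting (# 3) 12241 12024) ∷
  (node 6 5 40916262831 1320242730 , fitting (# 3) 12321 12104) ∷
  (node 6 5 40917262931 1321252730 , fitting (# 3) 10123 1340) ∷
  (node 6 4 20408131415 610121315 , mixed 7) ∷
  (node 6 4 20408131414 610121314 , mixed 7) ∷
  (node 6 5 40818252831 1222242729 , fitting (# 3) 12341 12124) ∷
  (node 6 5 40819242930 1223252628 , fitting (# 3) 15 232) ∷
  (node 6 5 40918242930 1322252628 , fitting (# 3) 5 222) ∷
  (node 6 5 40919242931 1323252728 , fitting (# 3) 10123 1340) ∷
  (node 6 4 20409121415 611121314 , mixed 6) ∷
  (node 6 4 20409121515 611121315 , mixed 6) ∷
  (node 6 5 41016252831 1420242729 , fitting (# 3) 12331 12114) ∷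
  (node 6 5 41017242930 1421252628 , fitting (# 3) 15 232) ∷
  (node 6 5 41116242930 1520252628 , fitting (# 3) 5 222) ∷
  (node 6 5 41117242931 1521252728 , fitting (# 3) 10113 1330) ∷
  (node 6 4 20508121415 710121314 , mixed 6) ∷
  (node 6 4 20508121515 710121315 , mixed 6) ∷
  (node 6 5 41018253031 1422262729 , fitting (# 3) 10124 1341) ∷
  (node 6 5 41019243031 1423262728 , fitting (# 3) 10024 1241) ∷
  (node 6 5 41118243031 1522262728 , fitting (# 3) 10104 1321) ∷
  (node 6 4 20509121515 711131314 , fitting (# 3) 123 340) ∷
  (node 6 5 70816272930 1523252628 , fitting (# 2) 345 10) ∷
  (node 6 4 30408131415 711121314 , mixed 7) ∷
  (node 6 4 30408131515 711121315 , mixed 7) ∷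
  (node 6 3 10204060707 305060607 , mixed 6) ∷
  (node 6 5 40816262728 1220242627 , mixed 7) ∷
  (node 6 5 40817262729 1221252627 , mixed 7) ∷
  (node 6 5 40916262729 1320252627 , mixed 7) ∷
  (node 6 5 50816262729 1321242627 , mixed 7) ∷
  (node 6 4 20408131314 610121313 , mixed 7) ∷
  (node 6 4 20408121314 610121213 , mixed 7) ∷
  (node 6 4 20409121315 611121313 , mixed 6) ∷
  (node 6 5 40818242530 1222242526 , mixed 6) ∷
  (node 6 5 40819242531 1223242527 , mixed 6) ∷
  (node 6 5 40918242531 1322242527 , mixed 6) ∷
  (node 6 5 50818242531 1323242526 , mixed 6) ∷
  (node 6 4 20409121215 611121213 , mixed 6) ∷
  (node 6 4 20508121315 710121313 , mixed 6) ∷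
  (node 6 5 41016242530 1420242526 , mixed 6) ∷
  (node 6 5 41017242531 1421242527 , mixed 6) ∷
  (node 6 5 41116242531 1520242527 , mixed 6) ∷
  (node 6 5 51016242531 1521242526 , mixed 6) ∷
  (node 6 4 20508121215 710121213 , mixed 6) ∷
  (node 6 5 60816262730 1422242627 , mixed 7) ∷
  (node 6 5 60817262731 1423252627 , mixed 7) ∷
  (node 6 5 60916262731 1522252627 , mixed 7) ∷
  (node 6 5 70816262731 1523242627 , mixed 7) ∷
  (node 6 4 30408131315 711121313 , mixed 7) ∷
  (node 6 4 30408121315 711121213 , mixed 7) ∷
  (node 6 3 10204060607 305060606 , mixed 6) ∷
  (node 6 2 102030303 102030303 , mixed 0) ∷
  (node 6 5 40816232930 1221222431 , fitting (# 3) 142 10042) ∷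
  (node 6 5 40817222831 1220232530 , fitting (# 3) 12215 2324) ∷
  (node 6 5 50816222831 1320232430 , fitting (# 3) 12313 12304) ∷
  (node 6 5 50817222931 1321232530 , fitting (# 3) 10122 10140) ∷
  (node 6 4 20408111415 610111215 , mixed 6) ∷
  (node 6 4 20408111414 610111214 , mixed 6) ∷
  (node 6 5 40818212831 1220232629 , fitting (# 3) 12315 12324) ∷
  (node 6 5 40819202930 1221222728 , fitting (# 3) 41 32) ∷
  (node 6 5 50818202930 1321222628 , fitting (# 3) 40 22) ∷
  (node 6 5 50819202931 1321232728 , fitting (# 3) 12305 12323) ∷
  (node 6 4 20409101415 610111314 , mixed 5) ∷
  (node 6 4 20409101515 610111315 , mixed 5) ∷
  (node 6 5 41116232930 1521222728 , fitting (# 2) 344 1110) ∷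
  (node 6 4 20508111415 710111314 , mixed 6) ∷
  (node 6 4 20508111515 710111315 , mixed 6) ∷
  (node 6 5 60816212831 1420232429 , fitting (# 3) 12314 12314) ∷
  (node 6 5 60817202930 1421222528 , fitting (# 3) 41 32) ∷
  (node 6 5 70816202930 1521222428 , fitting (# 3) 40 22) ∷
  (node 6 5 70817202931 1521232528 , fitting (# 3) 12304 12313) ∷
  (node 6 4 30408101415 710111214 , mixed 5) ∷
  (node 6 4 30408101515 710111215 , mixed 5) ∷
  (node 6 5 60818213031 1422232629 , fitting (# 3) 10132 10141) ∷
  (node 6 5 60819203031 1422232728 , fitting (# 3) 10032 141) ∷
  (node 6 5 70818203031 1522232628 , fitting (# 3) 12313 12304) ∷
  (node 6 4 30409101515 711111314 , fitting (# 3) 2305 12223) ∷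
  (node 6 3 10204050707 305050607 , mixed 5) ∷
  (node 6 5 40916232629 1321222427 , fitting (# 1) 344 1001) ∷
  (node 6 5 50816222729 1320232526 , fitting (# 1) 1345 2101) ∷
  (node 6 4 20408111314 610111213 , mixed 6) ∷
  (node 6 4 20408111214 610111212 , mixed 6) ∷
  (node 6 5 40918212431 1320232526 , fitting (# 1) 12123 2123) ∷
  (node 6 5 50818202531 1321222427 , fitting (# 1) 11122 1023) ∷
  (node 6 4 20409101215 610111213 , mixed 5) ∷
  (node 6 4 20409101315 610111313 , mixed 5) ∷
  (node 6 5 41016232530 1421222427 , fitting (# 1) 344 201) ∷
  (node 6 5 41017222431 1420232526 , fitting (# 1) 12123 12123) ∷
  (node 6 4 20508111215 710111213 , mixed 6) ∷
  (node 6 4 20508111315 710111313 , mixed 6) ∷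
  (node 6 5 60816212730 1420232526 , fitting (# 1) 1345 12101) ∷
  (node 6 5 60817202631 1421222427 , fitting (# 1) 11122 223) ∷
  (node 6 4 30408101315 710111213 , mixed 5) ∷
  (node 6 4 30408101215 710111212 , mixed 5) ∷
  (node 6 3 10204050607 305050606 , mixed 5) ∷
  (node 6 5 40917182831 1319202530 , fitting (# 1) 11323 1323) ∷
  (node 6 5 50817182831 1319212430 , fitting (# 1) 11322 323) ∷
  (node 6 4 20408091415 609101215 , mixed 5) ∷
  (node 6 4 20408091414 609101214 , mixed 5) ∷
  (node 6 5 40916192930 1317222728 , fitting (# 1) 10344 11001) ∷
  (node 6 5 50816192930 1317232628 , fitting (# 1) 10345 12001) ∷
  (node 6 4 20408091415 608111314 , mixed 4) ∷
  (node 6 4 20408091515 608111315 , mixed 4) ∷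
  (node 6 5 41016192930 1418212728 , fitting (# 1) 344 11001) ∷
  (node 6 5 41017182831 1419202629 , fitting (# 1) 12123 1323) ∷
  (node 6 4 20508091415 709101314 , mixed 5) ∷
  (node 6 4 20508091515 709101315 , mixed 5) ∷
  (node 6 5 60816192930 1418232528 , fitting (# 1) 345 12001) ∷
  (node 6 5 60817182831 1419222429 , fitting (# 1) 12122 323) ∷
  (node 6 4 30408091415 709111214 , mixed 5) ∷
  (node 6 4 30408091515 709111215 , mixed 5) ∷
  (node 6 3 10204040707 304050607 , mixed 4) ∷
  (node 6 5 40816192629 1218212427 , fitting (# 3) 10141 10132) ∷
  (node 6 5 40817182728 1219202526 , fitting (# 3) 2225 2225) ∷
  (node 6 5 50816182728 1319202426 , fitting (# 3) 2323 12205) ∷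
  (node 6 5 50817182729 1319212526 , fitting (# 3) 121 10030) ∷
  (node 6 4 20408091314 609101213 , mixed 5) ∷
  (node 6 4 20408091214 609101212 , mixed 5) ∷
  (node 6 5 40817182431 1216232526 , fitting (# 3) 12215 2324) ∷
  (node 6 5 40816192530 1217222427 , fitting (# 3) 141 10032) ∷
  (node 6 5 50816182530 1317222426 , fitting (# 3) 140 10022) ∷
  (node 6 5 50816192531 1317232427 , fitting (# 3) 12205 2323) ∷
  (node 6 4 20408091215 608111213 , mixed 4) ∷
  (node 6 4 20408091315 608111313 , mixed 4) ∷
  (node 6 5 41117182431 1519202526 , fitting (# 2) 1245 10302) ∷
  (node 6 4 20508091215 709101213 , mixed 5) ∷
  (node 6 4 20508091315 709101313 , mixed 5) ∷
  (node 6 5 60816192631 1418232427 , fitting (# 3) 12315 12324) ∷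
  (node 6 5 60817182730 1419222526 , fitting (# 3) 31 31) ∷
  (node 6 5 70816182730 1519222426 , fitting (# 3) 30 21) ∷
  (node 6 5 70817182731 1519232526 , fitting (# 3) 12305 12323) ∷
  (node 6 4 30408091315 709111213 , mixed 5) ∷
  (node 6 4 30408091215 709111212 , mixed 5) ∷
  (node 6 5 60816172629 1418212425 , fitting (# 3) 12324 12315) ∷
  (node 6 5 60816172728 1419202425 , fitting (# 3) 2324 12215) ∷
  (node 6 5 70816172729 1519212425 , fitting (# 3) 21 30) ∷
  (node 6 4 30408081314 709101212 , fitting (# 3) 40 22) ∷
  (node 6 3 10204040607 304050606 , mixed 4) ∷
  (node 6 2 102020303 102020303 , mixed 0) ∷
  (node 6 2 102020202 102020202 , mixed 0) ∷
  (node 6 1 1010101 1010101 , mixed 0) ∷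
  (node 6 5 40815162930 1314202431 , fitting (# 3) 2012 12002) ∷
  (node 6 5 40914162831 1215202530 , fitting (# 3) 11335 2344) ∷
  (node 6 5 50814162831 1215212430 , fitting (# 3) 11343 10344) ∷
  (node 6 5 50914162931 1315212530 , fitting (# 3) 10012 12010) ∷
  (node 6 4 20407081415 607101215 , mixed 4) ∷
  (node 6 4 20407081414 607101214 , mixed 4) ∷
  (node 6 5 40815192930 1314232728 , fitting (# 2) 2034 1220) ∷
  (node 6 4 20407091415 607111314 , mixed 4) ∷
  (node 6 4 20407091515 607111315 , mixed 4) ∷
  (node 6 5 41013162831 1215202629 , fitting (# 3) 11345 12344) ∷
  (node 6 5 41112162930 1314202728 , fitting (# 3) 2001 1002) ∷
  (node 6 5 51012162930 1314212628 , fitting (# 3) 2000 2) ∷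
  (node 6 5 51112162931 1315212728 , fitting (# 3) 10345 12343) ∷
  (node 6 4 20506081415 607101314 , mixed 3) ∷
  (node 6 4 20506081515 607101315 , mixed 3) ∷
  (node 6 5 60813162831 1215222429 , fitting (# 3) 11344 11344) ∷
  (node 6 5 60912162930 1314222528 , fitting (# 3) 2001 1002) ∷
  (node 6 5 70812162930 1314232428 , fitting (# 3) 2000 2) ∷
  (node 6 5 70912162931 1315232528 , fitting (# 3) 10344 11343) ∷
  (node 6 4 30406081415 607111214 , mixed 3) ∷
  (node 6 4 30406081515 607111215 , mixed 3) ∷
  (node 6 5 61013163031 1415222629 , fitting (# 3) 11012 12011) ∷
  (node 6 5 61112163031 1415222728 , fitting (# 3) 11002 2011) ∷
  (node 6 5 71012163031 1415232628 , fitting (# 3) 11343 10344) ∷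
  (node 6 4 30506081515 707111314 , fitting (# 3) 345 12333) ∷
  (node 6 3 10203040707 303050607 , mixed 3) ∷
  (node 6 5 40815172629 1314212427 , fitting (# 1) 2034 211) ∷
  (node 6 5 50814162729 1215212526 , fitting (# 1) 2135 321) ∷
  (node 6 4 20407081314 607101213 , mixed 4) ∷
  (node 6 4 20407081214 607101212 , mixed 4) ∷
  (node 6 5 40815182530 1314222427 , fitting (# 1) 2034 131) ∷
  (node 6 5 40914182431 1215222526 , fitting (# 1) 11313 11313) ∷
  (node 6 4 20407091215 607111213 , mixed 4) ∷
  (node 6 4 20407091315 607111313 , mixed 4) ∷
  (node 6 5 41013172431 1215212526 , fitting (# 1) 11313 1313) ∷
  (node 6 5 51012162531 1314212427 , fitting (# 1) 11212 1203) ∷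
  (node 6 4 20506081215 607101213 , mixed 3) ∷
  (node 6 4 20506081315 607101313 , mixed 3) ∷
  (node 6 5 60813162730 1215222526 , fitting (# 1) 2135 10321) ∷
  (node 6 5 60912162631 1314222427 , fitting (# 1) 11212 1033) ∷
  (node 6 4 30406081315 607111213 , mixed 3) ∷
  (node 6 4 30406081215 607111212 , mixed 3) ∷
  (node 6 3 10203040607 303050606 , mixed 3) ∷
  (node 6 5 40910172831 1112212530 , fitting (# 1) 11143 1143) ∷
  (node 6 5 50910162831 1113212430 , fitting (# 1) 11142 1043) ∷
  (node 6 4 20405081415 506101215 , mixed 3) ∷
  (node 6 4 20405081414 506101214 , mixed 3) ∷
  (node 6 5 40811182930 1013222728 , fitting (# 1) 2034 10211) ∷
  (node 6 5 40910182831 1112222629 , fitting (# 1) 11313 1143) ∷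
  (node 6 4 20405091415 506111314 , mixed 3) ∷
  (node 6 4 20405091515 506111315 , mixed 3) ∷
  (node 6 5 40811172930 914212728 , fitting (# 1) 12034 10211) ∷
  (node 6 5 50811162930 915212628 , fitting (# 1) 12035 10311) ∷
  (node 6 4 20405081415 407101314 , mixed 2) ∷
  (node 6 4 20405081515 407101315 , mixed 2) ∷
  (node 6 5 60811162930 1015222528 , fitting (# 1) 2035 10311) ∷
  (node 6 5 60910162831 1114222429 , fitting (# 1) 11312 1043) ∷
  (node 6 4 30405081415 507111214 , mixed 3) ∷
  (node 6 4 30405081515 507111215 , mixed 3) ∷
  (node 6 3 10202040707 203050607 , mixed 2) ∷
  (node 6 5 40811162629 1013202427 , fitting (# 3) 12011 11012) ∷
  (node 6 5 40910162728 1112202526 , fitting (# 3) 2335 2335) ∷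
  (node 6 5 50810162728 1112212426 , fitting (# 3) 2343 10335) ∷
  (node 6 5 50910162729 1113212526 , fitting (# 3) 11 11000) ∷
  (node 6 4 20405081314 506101213 , mixed 3) ∷
  (node 6 4 20405081214 506101212 , mixed 3) ∷
  (node 6 5 40910192431 1112232526 , fitting (# 2) 2125 10142) ∷
  (node 6 4 20405091215 506111213 , mixed 3) ∷
  (node 6 4 20405091315 506111313 , mixed 3) ∷
  (node 6 5 40910162431 815202526 , fitting (# 3) 11335 2344) ∷
  (node 6 5 40811162530 914202427 , fitting (# 3) 2011 11002) ∷
  (node 6 5 50810162530 914212426 , fitting (# 3) 2010 10002) ∷
  (node 6 5 50811162531 915212427 , fitting (# 3) 10335 2343) ∷
  (node 6 4 20405081215 407101213 , mixed 2) ∷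
  (node 6 4 20405081315 407101313 , mixed 2) ∷
  (node 6 5 60811162631 1015222427 , fitting (# 3) 11345 12344) ∷
  (node 6 5 60910162730 1114222526 , fitting (# 3) 1001 1001) ∷
  (node 6 5 70810162730 1114232426 , fitting (# 3) 1000 1) ∷
  (node 6 5 70910162731 1115232526 , fitting (# 3) 10345 12343) ∷
  (node 6 4 30405081315 507111213 , mixed 3) ∷
  (node 6 4 30405081215 507111212 , mixed 3) ∷
  (node 6 5 60809162629 1013222425 , fitting (# 3) 12344 11345) ∷
  (node 6 5 60809162728 1112222425 , fitting (# 3) 2344 11335) ∷
  (node 6 5 70809162729 1113232425 , fitting (# 3) 1 1000) ∷
  (node 6 4 30404081314 506111212 , fitting (# 3) 2000 2) ∷
  (node 6 3 10202040607 203050606 , mixed 2) ∷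
  (node 6 2 101020303 101020303 , mixed 0) ∷
  (node 6 5 40815172229 1314202325 , fitting (# 1) 2033 11211) ∷
  (node 6 5 40914162329 1215212225 , fitting (# 1) 2143 11321) ∷
  (node 6 4 20407081114 607101112 , mixed 4) ∷
  (node 6 4 20407081014 607101012 , mixed 4) ∷
  (node 6 5 40815182130 1314202326 , fitting (# 1) 2033 11131) ∷
  (node 6 5 50814182031 1215212226 , fitting (# 1) 11321 2313) ∷
  (node 6 4 20407091015 607101113 , mixed 4) ∷
  (node 6 4 20407091115 607111113 , mixed 4) ∷
  (node 6 5 41013162330 1215212226 , fitting (# 1) 2143 12321) ∷
  (node 6 5 51012162231 1314202326 , fitting (# 1) 11211 10033) ∷
  (node 6 4 20506081115 607101113 , mixed 3) ∷
  (node 6 4 20506081015 607101013 , mixed 3) ∷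
  (node 6 5 60813172031 1215212225 , fitting (# 1) 11321 10313) ∷
  (node 6 5 60912162131 1314202325 , fitting (# 1) 11211 10203) ∷
  (node 6 4 30406081015 607101112 , mixed 3) ∷
  (node 6 4 30406081115 607111112 , mixed 3) ∷
  (node 6 3 10203040507 303050506 , mixed 3) ∷
  (node 6 5 40815171828 1314192024 , fitting (# 2) 11311 115) ∷
  (node 6 4 20407080914 607091012 , mixed 4) ∷
  (node 6 5 40815171831 1314162327 , fitting (# 0) 45 12222) ∷
  (node 6 5 40914161931 1215172227 , fitting (# 0) 12222 45) ∷
  (node 6 5 50814161931 1215172326 , fitting (# 0) 2223 10044) ∷
  (node 6 5 50914161831 1315172226 , fitting (# 0) 10301 10112) ∷
  (node 6 4 20407080915 607081113 , mixed 4) ∷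
  (node 6 4 20407080814 607081012 , mixed 4) ∷
  (node 6 4 20407090915 607091113 , mixed 4) ∷
  (node 6 5 41013161931 1215182127 , fitting (# 0) 12232 1045) ∷
  (node 6 5 41112171831 1314192027 , fitting (# 0) 11312 10115) ∷
  (node 6 5 51012171831 1314192126 , fitting (# 0) 11311 115) ∷
  (node 6 5 51112161831 1315192026 , fitting (# 0) 11303 10214) ∷
  (node 6 4 20506080915 607091013 , mixed 3) ∷
  (node 6 4 20506080815 607081013 , mixed 3) ∷
  (node 6 5 60813161931 1215182325 , fitting (# 0) 2224 11044) ∷
  (node 6 5 60912171831 1314192225 , fitting (# 0) 11312 10115) ∷
  (node 6 5 70812171831 1314192324 , fitting (# 0) 11311 115) ∷
  (node 6 5 70912161831 1315192224 , fitting (# 0) 11320 214) ∷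
  (node 6 4 30406080915 607091112 , mixed 3) ∷
  (node 6 4 30406080815 607081112 , mixed 3) ∷
  (node 6 5 61013161731 1415182125 , fitting (# 0) 10301 10112) ∷
  (node 6 5 61112161731 1415192025 , fitting (# 0) 42 2211) ∷
  (node 6 5 71012161731 1415192124 , fitting (# 0) 125 12311) ∷
  (node 6 4 30506080815 707091012 , fitting (# 0) 11220 204) ∷
  (node 6 3 10203040407 303040506 , mixed 3) ∷
  (node 6 5 40910162328 1112212224 , fitting (# 2) 11220 204) ∷
  (node 6 4 20405081114 506101112 , mixed 3) ∷
  (node 6 4 20405081014 506101012 , mixed 3) ∷
  (node 6 5 40811182131 1013202327 , fitting (# 0) 12142 2125) ∷
  (node 6 5 40910192031 1112212227 , fitting (# 0) 11222 305) ∷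
  (node 6 5 50810192031 1112212326 , fitting (# 0) 10223 10304) ∷
  (node 6 5 50910182031 1113212226 , fitting (# 0) 11121 1005) ∷
  (node 6 4 20405091015 506101113 , mixed 3) ∷
  (node 6 4 20405091115 506111113 , mixed 3) ∷
  (node 6 5 40910162331 815212227 , fitting (# 0) 2115 11142) ∷
  (node 6 5 40811172231 914202327 , fitting (# 0) 11142 2115) ∷
  (node 6 5 50810172231 914212326 , fitting (# 0) 10211 302) ∷
  (node 6 5 50811162231 915202326 , fitting (# 0) 11043 2214) ∷
  (node 6 4 20405081115 407101113 , mixed 2) ∷
  (node 6 4 20405081015 407101013 , mixed 2) ∷
  (node 6 5 60811162131 1015202325 , fitting (# 0) 11044 2224) ∷
  (node 6 5 60910172031 1114212225 , fitting (# 0) 11212 10105) ∷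
  (node 6 5 70810172031 1114212324 , fitting (# 0) 11211 105) ∷
  (node 6 5 70910162031 1115212224 , fitting (# 0) 11220 204) ∷
  (node 6 4 30405081015 507101112 , mixed 3) ∷
  (node 6 4 30405081115 507111112 , mixed 3) ∷
  (node 6 5 60809182131 1013222325 , fitting (# 0) 10211 302) ∷
  (node 6 5 60809192031 1112222325 , fitting (# 0) 2112 10041) ∷
  (node 6 5 70809182031 1113222324 , fitting (# 0) 1204 11230) ∷
  (node 6 4 30404091015 506111112 , fitting (# 0) 11311 115) ∷
  (node 6 3 10202040507 203050506 , mixed 2) ∷
  (node 6 5 40811171829 1013192025 , fitting (# 1) 2033 12131) ∷
  (node 6 5 40910161929 1112182125 , fitting (# 1) 2143 12241) ∷
  (node 6 4 20405080914 506091012 , mixed 3) ∷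
  (node 6 5 40910161930 1112172226 , fitting (# 1) 2313 12241) ∷
  (node 6 5 50910161931 1113172326 , fitting (# 1) 11131 10203) ∷
  (node 6 4 20405080915 506081113 , mixed 3) ∷
  (node 6 4 20405080814 506081012 , mixed 3) ∷
  (node 6 4 20405090915 506091113 , mixed 3) ∷
  (node 6 5 40811171830 914192026 , fitting (# 1) 10033 12131) ∷
  (node 6 5 50811171831 915192126 , fitting (# 1) 12321 10313) ∷
  (node 6 4 20405080915 407091013 , mixed 2) ∷
  (node 6 4 20405080815 407081013 , mixed 2) ∷
  (node 6 5 60811171831 1015192225 , fitting (# 1) 11321 10313) ∷
  (node 6 5 60910161931 1114182325 , fitting (# 1) 11211 10203) ∷
  (node 6 4 30405080915 507091112 , mixed 3) ∷
  (node 6 4 30405080815 507081112 , mixed 3) ∷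
  (node 6 3 10202040407 203040506 , mixed 2) ∷
  (node 6 2 101020203 101020203 , mixed 0) ∷
  (node 6 2 101020202 101020202 , mixed 0) ∷
  (node 6 2 101030303 101030303 , mixed 0) ∷
  (node 6 1 10101 10101 , mixed 0) ∷
  (node 6 0 0 0 , mixed 0) ∷
  []


complete₅ : T (valid catalogue (0 , (1 , 5 , 5) ∷ []) [] nodes₅)
complete₅ = tt

complete₆ : T (valid catalogue (0 , (1 , 6 , 6) ∷ []) [] nodes₆)
complete₆ = tt

-- From a fit to an equivalent trade

conclude : ∀ {n} {τ : GR n} → IsTrade 2 τ → volume τ ≡ + 6 → Fit (plusBlocks τ) (minusBlocks τ) →
  Σ (GR n) λ τ′ → Equivalent τ τ′ × IsTrade 2 τ′ × volume τ′ ≡ + 6 × (Form1 τ′ ⊎ Form2 τ′ ⊎ Form3 τ′ ⊎ Form4 τ′)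
conclude {τ = τ} trade vol fit = translate (W fit) τ , return (shift (W fit) λ _ → refl) ,
  pairFree⇒trade (pairFree-translate (W fit) (trade⇒pairFree trade)) , trans (volume-translate (W fit) τ) vol ,
  toForm (Fit.index fit) (model fit (fromPair-blocks τ))

plusBlocks-length : ∀ {n} (τ : GR n) {k} → volume τ ≡ + k → length (plusBlocks τ) ≡ k
plusBlocks-length τ vol = +-injective (trans (length-plus τ) vol)

blocks-fit : ∀ {n} {τ : GR n} k cs → IsTrade 2 τ → volume τ ≡ + k → k ≤ 7 →
  T (valid catalogue (0 , (1 , k , k) ∷ []) [] cs) → Fit (plusBlocks τ) (minusBlocks τ)
blocks-fit {τ = τ} k cs trade vol k≤7 complete =
  Soundness.fit (plusBlocks τ) (minusBlocks τ) (blocks-balanced free) (blocks-apart τ) (subst (_≤ 7) (sym p≡k) k≤7) cs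
    (subst₂ (λ p m → T (valid catalogue (0 , (1 , p , m) ∷ []) [] cs)) (sym p≡k)
      (sym (trans (length-minus τ (proj₁ free)) p≡k)) complete)
  where
  free = trade⇒pairFree trade
  p≡k = plusBlocks-length τ vol

theorem6p7 : (n : ℕ) (T : GR n) → IsTrade 2 T → (volume T ≡ + 5 ⊎ volume T ≡ + 6) →
    Σ (GR n) λ T′ → Equivalent T T′ × IsTrade 2 T′ × volume T′ ≡ + 6 ×
    (Form1 T′ ⊎ Form2 T′ ⊎ Form3 T′ ⊎ Form4 T′)
-- The certificate yields a fit here as well, which forces `plusBlocks T` to have length 6 instead
-- of 5.
theorem6p7 n T trade (inj₁ vol) = contradiction
  (trans (sym (plusBlocks-length T vol)) (length-P₀ (blocks-fit 5 nodes₅ trade vol (m≤m+n 5 2) complete₅))) λ ()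
theorem6p7 n T trade (inj₂ vol) = conclude trade vol (blocks-fit 6 nodes₆ trade vol (m≤m+n 6 1) complete₆)
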